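{- Let $H$ be a fixed graph with $h$ vertices. For every $\varepsilon > 0$ there exists $\varepsilon' > 0$ such that the following holds. If $G$ is a graph with $n$ vertices, where $h$ divides $n$, such that $\delta(G) \ge \varepsilon n$ and $\alpha_H^*(G) \le \varepsilon' n$, then $G$ contains an $H$-factor.
   Context: For a graph $G$, $\delta(G)$ is its minimum degree. For graphs $H$ and $G$ with $h = |V(H)|$, $\alpha_H^*(G)$ is defined as the smallest number such that for every choice of $h$ pairwise disjoint subsets $V_1, \ldots, V_h \subseteq V(G)$ with $|V_i| \ge \alpha_H^*(G)$ for all $i$, the $h$-partite subgraph of $G$ induced by $V_1,\dots,V_h$ (i.e. consisting of the edges of $G$ between distinct $V_i$'s) contains a copy of $H$ with exactly one vertex in each $V_i$. An $H$-factor of $G$ is a collection of vertex-disjoint copies of $H$ in $G$ (not necessarily induced) covering all vertices of $G$. -}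

module Defs where

open import Data.Nat using (ℕ)
open import Data.Integer using (+_)
open import Data.Rational using (ℚ; _/_)
open import Data.Bool using (Bool; true; false)
open import Data.Fin using (Fin)
open import Data.Fin.Subset using (Subset; _∈_; ∣_∣)
open import Data.Vec using (tabulate)
open import Data.Product using (Σ; _×_)
open import Function.Definitions using (Injective)
open import Relation.Binary.PropositionalEquality using (_≡_; _≢_)

record Graph (n : ℕ) : Set where
  field
    adj   : Fin n → Fin n → Bool
    sym   : ∀ u v → adj u v ≡ adj v u
    irrfl : ∀ v → adj v v ≡ false
open Graph public

Adj : ∀ {n} → Graph n → Fin n → Fin n → Set
Adj G u v = adj G u v ≡ true

ℕtoℚ : ℕ → ℚ
ℕtoℚ m = (+ m) / 1

nbhd : ∀ {n} → Graph n → Fin n → Subset n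
nbhd G v = tabulate (adj G v)

degree : ∀ {n} → Graph n → Fin n → ℕ
degree G v = ∣ nbhd G v ∣

MinDegAtLeast : ∀ {n} → Graph n → ℚ → Set
MinDegAtLeast G q = ∀ v → q Data.Rational.≤ ℕtoℚ (degree G v)

IsCopy : ∀ {h n} → Graph h → Graph n → (Fin h → Fin n) → Set
IsCopy H G φ = Injective _≡_ _≡_ φ × (∀ i j → Adj H i j → Adj G (φ i) (φ j))

PairwiseDisjoint : ∀ {h n} → (Fin h → Subset n) → Set
PairwiseDisjoint {h} {n} V = ∀ (i j : Fin h) (v : Fin n) → v ∈ V i → v ∈ V j → i ≡ j

-- the h-partite subgraph induced by V₁..V_h contains a copy of H with exactly
-- one vertex in each Vᵢ: a bijection σ of the vertices of H onto the parts and
-- an edge-preserving map φ with φ j ∈ V (σ j).  (Edges used lie between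
-- distinct parts since H is loopless and σ is injective.)
HasTransversalCopy : ∀ {h n} → Graph h → Graph n → (Fin h → Subset n) → Set
HasTransversalCopy {h} {n} H G V =
  Σ (Fin h → Fin h) λ σ → Injective _≡_ _≡_ σ ×
  Σ (Fin h → Fin n) λ φ → (∀ j → φ j ∈ V (σ j)) × IsCopy H G φ

AlphaProp : ∀ {h n} → Graph h → Graph n → ℕ → Set
AlphaProp {h} {n} H G t =
  ∀ (V : Fin h → Subset n) → PairwiseDisjoint V → (∀ i → t Data.Nat.≤ ∣ V i ∣) →
  HasTransversalCopy H G V

IsAlphaStar : ∀ {h n} → Graph h → Graph n → ℕ → Set
IsAlphaStar H G a = AlphaProp H G a × (∀ t → AlphaProp H G t → a Data.Nat.≤ t)

HFactor : ∀ {h n} → Graph h → Graph n → Set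
HFactor {h} {n} H G =
  Σ ℕ λ m → Σ (Fin m → Fin h → Fin n) λ φ →
    (∀ k → IsCopy H G (φ k)) ×
    (∀ k k' j j' → φ k j ≡ φ k' j' → k ≡ k') ×
    (∀ v → Σ (Fin m) λ k → Σ (Fin h) λ j → φ k j ≡ v)

{-# OPTIONS --safe #-}
module Submission where

-- If S is a set of |H| - 1 vertices inside N(v) and p + S spans H, then so does v + S; hence v can be
-- exchanged for p.  Choosing p from any set of α* vertices, two arbitrary vertices x and y can be linked by
-- a set K of bounded size such that both x + K and y + K are tiled, and by linking one builds, for any list
-- of vertices, a gadget that is tiled together with any one of them.
--
-- Take a sparse bipartite graph with 8u slots on one side and 4u points on the other in which every set of at
-- most u slots has at least as many neighbours; it comes from a greedily chosen hitting set after deleting a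
-- maximal non-expanding set.  Put a gadget at every point and a vertex at every slot, in h = |H| copies with
-- disjoint slots X₁, …, X_h of initially matched vertices and a common set Y of flexible ones.  If a flexible
-- vertex is left over, it can be exchanged along alternating paths with more than u ≥ α* matched ones.
--
-- The rest of G is tiled greedily up to fewer than h α* vertices, which are absorbed into copies of H using
-- their neighbours in Y.  The remaining vertices of Y are removed h at a time: the j-th one is exchanged in
-- the j-th structure, and the h sets of possible replacements contain a transversal copy of H.

open import Defs hiding (sym)
import Algebra.Solver.CommutativeMonoid as CommutativeMonoidSolver
open import Data.Bool as Bool using (Bool; true; false; _∧_)
open import Data.Empty using (⊥; ⊥-elim)
open import Data.Fin as Fin using (Fin; zero; suc)
import Data.Fin.Properties as Fin
import Data.Fin.Subset as Subset
import Data.Fin.Subset.Properties as Subset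
open import Data.Integer as ℤ using () renaming (+_ to pos)
import Data.Integer.Properties as ℤ
open import Data.List using (List; []; _∷_; _++_; [_]; length; map; filter; concat; tabulate; allFin; take; drop; lookup; cartesianProduct; mapMaybe)
import Data.List.Properties as List
import Data.List.Membership.DecPropositional as DecMembership
open import Data.List.Membership.Propositional using (_∈_; _∉_; find; lose)
open import Data.List.Membership.Propositional.Properties using (∈-++⁺ˡ; ∈-++⁺ʳ; ∈-++⁻; ∈-filter⁻; ∈-filter⁺; ∈-∃++; ∈-map⁻; ∈-map⁺; ∈-concat⁺′; ∈-concat⁻′; ∈-cartesianProduct⁺; ∈-allFin; ∈-tabulate⁺; ∈-tabulate⁻)
open import Data.List.Relation.Binary.Disjoint.Propositional using (Disjoint)
open import Data.List.Relation.Binary.Permutation.Propositional as Perm using (_↭_; ↭-refl; ↭-sym; ↭-trans; ↭-reflexive; prep; swap; ↭⇒↭ₛ)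
open import Data.List.Relation.Binary.Permutation.Propositional.Properties as Perm using (↭-length; ∈-resp-↭; shift)
import Data.List.Relation.Binary.Permutation.Setoid.Properties as PermSetoid
open import Data.List.Relation.Binary.Subset.Propositional using (_⊆_)
open import Data.List.Relation.Unary.All as All using (All; []; _∷_)
import Data.List.Relation.Unary.All.Properties as All
open import Data.List.Relation.Unary.AllPairs using ([]; _∷_)
open import Data.List.Relation.Unary.Any as Any using (Any; any?; here; there)
import Data.List.Relation.Unary.Any.Properties as Any
import Data.List.Relation.Unary.Unique.DecPropositional as DecUnique
open import Data.List.Relation.Unary.Unique.Propositional using (Unique)
import Data.List.Relation.Unary.Unique.Propositional.Properties as Unique
open import Data.Maybe using (Maybe; just; nothing)
import Data.Maybe.Relation.Unary.Any as Maybe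
open import Data.Nat using (ℕ; zero; suc; _+_; _*_; _∸_; _^_; _/_; _%_; _≤_; _<_; z≤n; s≤s; _≤?_; _<?_; NonZero; >-nonZero)
open import Data.Nat.DivMod using (m≡m%n+[m/n]*n; m%n<n; m/n*n≤m; m*n/n≡m; /-monoˡ-≤)
open import Data.Nat.Divisibility using (_∣_; divides; ∣m∣n⇒∣m+n; ∣m+n∣m⇒∣n; ∣-refl; _∣0; 0∣⇒≡0)
open import Data.Nat.Properties
open import Data.Nat.Solver using (module +-*-Solver)
open import Data.Product using (Σ; ∃; ∃₂; _×_; _,_; proj₁; proj₂)
open import Data.Product.Properties using (≡-dec)
open import Data.Rational as ℚ using (ℚ; 0ℚ; mkℚ; toℚᵘ)
import Data.Rational.Properties as ℚ
open import Data.Rational.Unnormalised as ℚᵘ using (mkℚᵘ; *≤*)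
import Data.Rational.Unnormalised.Properties as ℚᵘ
open import Data.Sum using (_⊎_; inj₁; inj₂; [_,_]′)
import Data.Sum.Properties as Sum
import Data.Vec as Vec
open import Data.Vec.Functional using (updateAt) renaming (_∷_ to _◂_)
open import Data.Vec.Functional.Properties using (updateAt-updates; updateAt-minimal)
import Data.Vec.Properties as Vec
open import Function using (_∘_; id; const)
open import Function.Definitions using (Injective)
open import Relation.Binary.Definitions using (DecidableEquality)
open import Relation.Binary.PropositionalEquality using (_≡_; _≢_; refl; sym; trans; cong; cong₂; subst; subst₂; setoid; module ≡-Reasoning)
open import Relation.Nullary using (¬_; Dec; yes; no; does; ¬?; _×-dec_; contradiction)
open import Relation.Unary using (Decidable)
open +-*-Solver using (solve; _:=_; _:+_; _:*_; con)

private variable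
  A B : Set
  x : A
  xs ys : List A

-- Finite sums and duplicate-free lists

∑ : List A → (A → ℕ) → ℕ
∑ []       f = 0
∑ (x ∷ xs) f = f x + ∑ xs f

⟦_⟧ : Bool → ℕ
⟦ true  ⟧ = 1
⟦ false ⟧ = 0

⟦⟧≤1 : ∀ b → ⟦ b ⟧ ≤ 1
⟦⟧≤1 true  = ≤-refl
⟦⟧≤1 false = z≤n

∑-mono : ∀ (xs : List A) {f g : A → ℕ} → (∀ {x} → x ∈ xs → f x ≤ g x) → ∑ xs f ≤ ∑ xs g
∑-mono []       f≤g = z≤n
∑-mono (x ∷ xs) f≤g = +-mono-≤ (f≤g (here refl)) (∑-mono xs (f≤g ∘ there))

∑-cong : ∀ (xs : List A) {f g : A → ℕ} → (∀ x → f x ≡ g x) → ∑ xs f ≡ ∑ xs g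
∑-cong []       f≡g = refl
∑-cong (x ∷ xs) f≡g = cong₂ _+_ (f≡g x) (∑-cong xs f≡g)

∑-const : ∀ (xs : List A) c → ∑ xs (λ _ → c) ≡ length xs * c
∑-const []       c = refl
∑-const (x ∷ xs) c = cong (c +_) (∑-const xs c)

∑-distribˡ : ∀ (xs : List A) c (f : A → ℕ) → ∑ xs (λ x → c * f x) ≡ c * ∑ xs f
∑-distribˡ []       c f = sym (*-zeroʳ c)
∑-distribˡ (x ∷ xs) c f = begin
  c * f x + ∑ xs (λ x → c * f x)  ≡⟨ cong (c * f x +_) (∑-distribˡ xs c f) ⟩
  c * f x + c * ∑ xs f            ≡⟨ *-distribˡ-+ c (f x) (∑ xs f) ⟨
  c * (f x + ∑ xs f)              ∎
  where open ≡-Reasoning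

∑-+ : ∀ (xs : List A) (f g : A → ℕ) → ∑ xs (λ x → f x + g x) ≡ ∑ xs f + ∑ xs g
∑-+ []       f g = refl
∑-+ (x ∷ xs) f g rewrite ∑-+ xs f g =
  solve 4 (λ a b c d → (a :+ b) :+ (c :+ d) := (a :+ c) :+ (b :+ d)) refl (f x) (g x) (∑ xs f) (∑ xs g)

∑-++ : ∀ (xs ys : List A) (f : A → ℕ) → ∑ (xs ++ ys) f ≡ ∑ xs f + ∑ ys f
∑-++ []       ys f = refl
∑-++ (x ∷ xs) ys f = trans (cong (f x +_) (∑-++ xs ys f)) (sym (+-assoc (f x) (∑ xs f) (∑ ys f)))

∑-map : ∀ (g : A → B) (xs : List A) (f : B → ℕ) → ∑ (map g xs) f ≡ ∑ xs (f ∘ g)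
∑-map g []       f = refl
∑-map g (x ∷ xs) f = cong (f (g x) +_) (∑-map g xs f)

∑-swap : ∀ (xs : List A) (ys : List B) (f : A → B → ℕ) →
         ∑ xs (λ x → ∑ ys (f x)) ≡ ∑ ys (λ y → ∑ xs (λ x → f x y))
∑-swap []       ys f = sym (trans (∑-const ys 0) (*-zeroʳ (length ys)))
∑-swap (x ∷ xs) ys f = trans (cong (∑ ys (f x) +_) (∑-swap xs ys f))
                             (sym (∑-+ ys (f x) (λ y → ∑ xs (λ x → f x y))))

∑-↭ : ∀ {xs ys : List A} (f : A → ℕ) → xs ↭ ys → ∑ xs f ≡ ∑ ys f
∑-↭ f Perm.refl    = refl
∑-↭ f (prep x p)   = cong (f x +_) (∑-↭ f p)
∑-↭ f (swap {xs} {ys} x y p) rewrite ∑-↭ f p =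
  solve 3 (λ a b c → a :+ (b :+ c) := b :+ (a :+ c)) refl (f x) (f y) (∑ ys f)
∑-↭ f (Perm.trans p q)  = trans (∑-↭ f p) (∑-↭ f q)

length-filter : ∀ {P : A → Set} (P? : Decidable P) xs → length (filter P? xs) ≡ ∑ xs (λ x → ⟦ does (P? x) ⟧)
length-filter P? []       = refl
length-filter P? (x ∷ xs) with does (P? x)
... | true  = cong suc (length-filter P? xs)
... | false = length-filter P? xs

∑-bounded : ∀ (xs : List A) (f : A → ℕ) → (∀ x → f x ≤ 1) → ∑ xs f ≤ length xs
∑-bounded xs f f≤1 = ≤-trans (∑-mono xs (λ {x} _ → f≤1 x))
  (≤-reflexive (trans (∑-const xs 1) (*-identityʳ (length xs))))

opaque
  average : ∀ (xs : List A) (f : A → ℕ) c → 0 < length xs → length xs * c ≤ ∑ xs f →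
            ∃ λ x → x ∈ xs × c ≤ f x
  average (x ∷ xs) f c _ p = go x xs p
    where
    go : ∀ x xs → length (x ∷ xs) * c ≤ ∑ (x ∷ xs) f → ∃ λ y → y ∈ x ∷ xs × c ≤ f y
    go x [] p = x , here refl , subst (c ≤_) (+-identityʳ (f x)) (subst (_≤ f x + 0) (+-identityʳ c) p)
    go x (x′ ∷ xs) p with c ≤? f x
    ... | yes c≤fx = x , here refl , c≤fx
    ... | no  c≰fx with go x′ xs (+-cancelˡ-≤ c _ _ (≤-trans p (+-monoˡ-≤ _ (<⇒≤ (≰⇒> c≰fx)))))
    ...   | y , y∈ , c≤fy = y , there y∈ , c≤fy

Unique-resp-↭ : xs ↭ ys → Unique xs → Unique ys
Unique-resp-↭ {A} p = PermSetoid.Unique-resp-↭ (setoid A) (↭⇒↭ₛ p)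

Unique-++⁻ˡ : ∀ (xs : List A) {ys} → Unique (xs ++ ys) → Unique xs
Unique-++⁻ˡ []       _        = []
Unique-++⁻ˡ (x ∷ xs) (p ∷ u) = All.++⁻ˡ xs p ∷ Unique-++⁻ˡ xs u

Unique-++⁻ʳ : ∀ (xs : List A) {ys} → Unique (xs ++ ys) → Unique ys
Unique-++⁻ʳ []       u        = u
Unique-++⁻ʳ (x ∷ xs) (_ ∷ u) = Unique-++⁻ʳ xs u

Unique-++⇒Disjoint : ∀ (xs : List A) {ys} → Unique (xs ++ ys) → Disjoint xs ys
Unique-++⇒Disjoint (x ∷ xs) (p ∷ u) (here refl , v∈ys) = All.lookup p (∈-++⁺ʳ xs v∈ys) refl
Unique-++⇒Disjoint (x ∷ xs) (p ∷ u) (there v∈xs , v∈ys) = Unique-++⇒Disjoint xs u (v∈xs , v∈ys)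

opaque
  extract : x ∈ xs → ∃ λ ys → xs ↭ x ∷ ys
  extract x∈xs with ∈-∃++ x∈xs
  ... | ys , zs , refl = ys ++ zs , shift _ ys zs

opaque
  -- Set difference, with sets as lists up to permutation. The entries of `xs` are extracted one at
  -- a time; as they are distinct, the later ones survive the removal of the earlier ones.
  complement : Unique xs → xs ⊆ ys → ∃ λ zs → ys ↭ xs ++ zs
  complement {xs = []}             _       _     = _ , ↭-refl
  complement {xs = x ∷ xs} {ys} (p ∷ u) xs⊆ys with extract (xs⊆ys (here refl))
  ... | ws , ys↭x∷ws with complement u xs⊆ws
    where
    xs⊆ws : xs ⊆ ws
    xs⊆ws v∈xs with ∈-resp-↭ ys↭x∷ws (xs⊆ys (there v∈xs))
    ... | here refl = ⊥-elim (All.lookup p v∈xs refl)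
    ... | there v∈ws = v∈ws
  ...   | zs , ws↭ = zs , ↭-trans ys↭x∷ws (prep x ws↭)

Unique-⊆-length : Unique xs → xs ⊆ ys → length xs ≤ length ys
Unique-⊆-length {xs = xs} {ys} u xs⊆ys with complement u xs⊆ys
... | zs , p = subst (length xs ≤_) (sym (trans (↭-length p) (List.length-++ xs))) (m≤m+n (length xs) (length zs))

Unique-⊆-↭ : Unique xs → xs ⊆ ys → length ys ≤ length xs → xs ↭ ys
Unique-⊆-↭ {xs = xs} {ys} u xs⊆ys |ys|≤|xs| with complement u xs⊆ys
... | []     , p = ↭-sym (↭-trans p (Perm.++-identityʳ xs))
... | z ∷ zs , p = ⊥-elim (<⇒≱ (≤-trans (m<m+n (length xs) (s≤s z≤n))
        (≤-reflexive (sym (trans (↭-length p) (List.length-++ xs))))) |ys|≤|xs|)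

filter-++-↭ : ∀ {P : A → Set} (P? : Decidable P) xs → xs ↭ filter P? xs ++ filter (¬? ∘ P?) xs
filter-++-↭ P? []       = ↭-refl
filter-++-↭ P? (x ∷ xs) with does (P? x)
... | true  = prep x (filter-++-↭ P? xs)
... | false = ↭-trans (prep x (filter-++-↭ P? xs)) (↭-sym (shift x (filter P? xs) _))

Disjoint-⊆ : ∀ {xs xs′ ys ys′ : List A} → xs ⊆ xs′ → ys ⊆ ys′ → Disjoint xs′ ys′ → Disjoint xs ys
Disjoint-⊆ p q d (v∈xs , v∈ys) = d (p v∈xs , q v∈ys)

take-⊆ : ∀ m (xs : List A) → take m xs ⊆ xs
take-⊆ m xs v∈ = subst (_ ∈_) (List.take++drop≡id m xs) (∈-++⁺ˡ v∈)

drop-⊆ : ∀ m (xs : List A) → drop m xs ⊆ xs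
drop-⊆ m xs v∈ = subst (_ ∈_) (List.take++drop≡id m xs) (∈-++⁺ʳ (take m xs) v∈)

length-take-≤ : ∀ m (xs : List A) → m ≤ length xs → length (take m xs) ≡ m
length-take-≤ m xs m≤ = trans (List.length-take m xs) (m≤n⇒m⊓n≡m m≤)

module _ (_≟_ : DecidableEquality A) where
  open DecMembership _≟_ using (_∈?_)

  opaque
    -- At most `length ys` of the distinct entries of `xs` can lie in `ys`. This is how fresh
    -- vertices are found: `ys` holds the forbidden ones.
    avoid : ∀ xs (ys : List A) m → Unique xs → length ys + m ≤ length xs →
            ∃ λ zs → Unique zs × zs ⊆ xs × Disjoint zs ys × length zs ≡ m
    avoid xs ys m u le = take m out , Unique.take⁺ m (Unique.filter⁺ ∉ys? u) ,
        (proj₁ ∘ ∈-filter⁻ ∉ys? ∘ take-⊆ m out) ,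
        (λ (v∈ , v∈ys) → proj₂ (∈-filter⁻ ∉ys? {xs = xs} (take-⊆ m out v∈)) v∈ys) ,
        length-take-≤ m out (+-cancelˡ-≤ (length ys) _ _ (≤-trans le bound))
      where
      ∉ys? : Decidable (λ x → ¬ (x ∈ ys))
      ∉ys? = ¬? ∘ (_∈? ys)
      out inn : List A
      out = filter ∉ys? xs
      inn = filter (_∈? ys) xs
      bound : length xs ≤ length ys + length out
      bound = begin
        length xs              ≡⟨ ↭-length (filter-++-↭ (_∈? ys) xs) ⟩
        length (inn ++ out)    ≡⟨ List.length-++ inn ⟩
        length inn + length out ≤⟨ +-monoˡ-≤ (length out)
            (Unique-⊆-length (Unique.filter⁺ (_∈? ys) u) (proj₂ ∘ ∈-filter⁻ (_∈? ys) {xs = xs})) ⟩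
        length ys + length out ∎
        where open ≤-Reasoning

-- `Unique (⋃ F)` expresses at once that each `F i` is free of repetitions and that these lists are
-- pairwise disjoint.
⋃ : ∀ {m} → (Fin m → List A) → List A
⋃ = concat ∘ tabulate

∈-⋃ : ∀ {m} {F : Fin m → List A} i → x ∈ F i → x ∈ ⋃ F
∈-⋃ {F = F} i x∈ = ∈-concat⁺′ x∈ (Any.tabulate⁺ i refl)

⋃-cong : ∀ {m} {F F′ : Fin m → List A} → (∀ i → F i ↭ F′ i) → ⋃ F ↭ ⋃ F′
⋃-cong {m = zero}  p = ↭-refl
⋃-cong {m = suc m} p = Perm.++⁺ (p zero) (⋃-cong (p ∘ suc))

⋃-++ : ∀ {m} (F F′ : Fin m → List A) → ⋃ (λ i → F i ++ F′ i) ↭ ⋃ F ++ ⋃ F′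
⋃-++ {m = zero}  F F′ = ↭-refl
⋃-++ {A} {m = suc m} F F′ = ↭-trans (Perm.++⁺ˡ (F zero ++ F′ zero) (⋃-++ (F ∘ suc) (F′ ∘ suc)))
  (solve↭ 4 (λ a b c d → (a ⊕ b) ⊕ (c ⊕ d) ⊜ (a ⊕ c) ⊕ (b ⊕ d)) ↭-refl (F zero) (F′ zero) (⋃ (F ∘ suc)) (⋃ (F′ ∘ suc)))
  where open CommutativeMonoidSolver (Perm.++-commutativeMonoid {A = A}) using (_⊕_; _⊜_) renaming (solve to solve↭)

⋃-singleton : ∀ {m} (f : Fin m → A) → ⋃ (λ i → [ f i ]) ≡ tabulate f
⋃-singleton {m = zero}  f = refl
⋃-singleton {m = suc m} f = cong (f zero ∷_) (⋃-singleton (f ∘ suc))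

Unique-⋃⁻ : ∀ {m} {F : Fin m → List A} → Unique (⋃ F) → ∀ i → Unique (F i)
Unique-⋃⁻ {F = F} u zero    = Unique-++⁻ˡ (F zero) u
Unique-⋃⁻ {F = F} u (suc i) = Unique-⋃⁻ (Unique-++⁻ʳ (F zero) u) i

Unique-⋃-index : ∀ {m} {F : Fin m → List A} → Unique (⋃ F) → ∀ {i j} → x ∈ F i → x ∈ F j → i ≡ j
Unique-⋃-index u {zero} {zero} _ _ = refl
Unique-⋃-index {F = F} u {zero} {suc j} x∈ x∈′ =
  ⊥-elim (Unique-++⇒Disjoint (F zero) u (x∈ , ∈-⋃ {F = F ∘ suc} j x∈′))
Unique-⋃-index {F = F} u {suc i} {zero} x∈ x∈′ =
  ⊥-elim (Unique-++⇒Disjoint (F zero) u (x∈′ , ∈-⋃ {F = F ∘ suc} i x∈))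
Unique-⋃-index {F = F} u {suc i} {suc j} x∈ x∈′ = cong suc (Unique-⋃-index (Unique-++⁻ʳ (F zero) u) x∈ x∈′)

opaque
  chunks : ∀ {A : Set} m b (xs : List A) → m * b ≤ length xs →
           ∃₂ λ (F : Fin m → List A) rest → (∀ i → length (F i) ≡ b) × ⋃ F ++ rest ≡ xs
  chunks zero    b xs _  = (λ ()) , xs , (λ ()) , refl
  chunks {A} (suc m) b xs le with chunks m b (drop b xs)
      (subst (m * b ≤_) (sym (List.length-drop b xs)) (subst (_≤ length xs ∸ b) (m+n∸m≡n b (m * b)) (∸-monoˡ-≤ b le)))
  ... | F , rest , |F| , eq = F′ , rest , |F′| ,
        trans (List.++-assoc (take b xs) (⋃ F) rest) (trans (cong (take b xs ++_) eq) (List.take++drop≡id b xs))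
    where
    F′ : Fin (suc m) → List A
    F′ zero    = take b xs
    F′ (suc i) = F i
    |F′| : ∀ i → length (F′ i) ≡ b
    |F′| zero    = length-take-≤ b xs (≤-trans (m≤m+n b (m * b)) le)
    |F′| (suc i) = |F| i

opaque
  untabulate : ∀ {m} (xs : List A) → length xs ≡ m → ∃ λ (f : Fin m → A) → tabulate f ≡ xs
  untabulate xs refl = lookup xs , List.tabulate-lookup xs

∑-cartesianProduct : ∀ (xs : List A) (ys : List B) f →
                     ∑ (cartesianProduct xs ys) f ≡ ∑ xs (λ x → ∑ ys (λ y → f (x , y)))
∑-cartesianProduct []       ys f = refl
∑-cartesianProduct (x ∷ xs) ys f = trans (∑-++ (map (x ,_) ys) _ f)
  (cong₂ _+_ (∑-map (x ,_) ys f) (∑-cartesianProduct xs ys f))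

length-∑ : ∀ (xs : List A) → length xs ≡ ∑ xs (λ _ → 1)
length-∑ xs = sym (trans (∑-const xs 1) (*-identityʳ (length xs)))

length-cartesianProduct : ∀ (xs : List A) (ys : List B) → length (cartesianProduct xs ys) ≡ length xs * length ys
length-cartesianProduct xs ys = begin
  length (cartesianProduct xs ys)         ≡⟨ length-∑ (cartesianProduct xs ys) ⟩
  ∑ (cartesianProduct xs ys) (λ _ → 1)    ≡⟨ ∑-cartesianProduct xs ys (λ _ → 1) ⟩
  ∑ xs (λ _ → ∑ ys (λ _ → 1))             ≡⟨ ∑-const xs (∑ ys (λ _ → 1)) ⟩
  length xs * ∑ ys (λ _ → 1)              ≡⟨ cong (length xs *_) (length-∑ ys) ⟨
  length xs * length ys                   ∎
  where open ≡-Reasoning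

-- Power sets and greedy hitting sets

subsets : List A → List (List A)
subsets []       = [ [] ]
subsets (x ∷ xs) = map (x ∷_) (subsets xs) ++ subsets xs

length-subsets : ∀ (xs : List A) → length (subsets xs) ≡ 2 ^ length xs
length-subsets []       = refl
length-subsets (x ∷ xs) = begin
  length (map (x ∷_) (subsets xs) ++ subsets xs)   ≡⟨ List.length-++ (map (x ∷_) (subsets xs)) ⟩
  length (map (x ∷_) (subsets xs)) + length (subsets xs)
    ≡⟨ cong₂ _+_ (trans (List.length-map (x ∷_) (subsets xs)) (length-subsets xs)) (length-subsets xs) ⟩
  2 ^ length xs + 2 ^ length xs                    ≡⟨ cong (2 ^ length xs +_) (+-identityʳ _) ⟨
  2 * 2 ^ length xs                                ∎
  where open ≡-Reasoning

-- A set listed in any order has a normal form among the sublists of `xs`, the filter by membership.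
-- Quantification over sets thus becomes a finite search.
filter∈subsets : ∀ {P : A → Set} (P? : Decidable P) xs → filter P? xs ∈ subsets xs
filter∈subsets P? []       = here refl
filter∈subsets P? (x ∷ xs) with does (P? x)
... | true  = ∈-++⁺ˡ (∈-map⁺ (x ∷_) (filter∈subsets P? xs))
... | false = ∈-++⁺ʳ (map (x ∷_) (subsets xs)) (filter∈subsets P? xs)

-- Each greedily chosen element hits at least a 1/(1+κ) fraction of the targets not yet hit.
module HittingSet {T E : Set} {Hit : T → E → Set} (hit? : ∀ t e → Dec (Hit t e))
                  (κ : ℕ) (es : List E) (es≢[] : 0 < length es) where

  Popular : T → Set
  Popular t = length es ≤ suc κ * ∑ es (λ e → ⟦ does (hit? t e) ⟧)

  -- Double counting: summed over the targets, the hits number at least `length ts * length es`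
  -- divided by `suc κ`; summed over the elements, one of them reaches the average.
  popular-element : ∀ ts → (∀ {t} → t ∈ ts → Popular t) →
    ∃ λ e → e ∈ es × length ts ≤ suc κ * ∑ ts (λ t → ⟦ does (hit? t e) ⟧)
  popular-element ts pop = average es (λ e → suc κ * ∑ ts (λ t → ⟦ does (hit? t e) ⟧)) (length ts) es≢[] (begin
    length es * length ts
      ≡⟨ *-comm (length es) (length ts) ⟩
    length ts * length es
      ≡⟨ ∑-const ts (length es) ⟨
    ∑ ts (λ _ → length es)
      ≤⟨ ∑-mono ts pop ⟩
    ∑ ts (λ t → suc κ * ∑ es (λ e → ⟦ does (hit? t e) ⟧))
      ≡⟨ ∑-distribˡ ts (suc κ) _ ⟩
    suc κ * ∑ ts (λ t → ∑ es (λ e → ⟦ does (hit? t e) ⟧))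
      ≡⟨ cong (suc κ *_) (∑-swap ts es (λ t e → ⟦ does (hit? t e) ⟧)) ⟩
    suc κ * ∑ es (λ e → ∑ ts (λ t → ⟦ does (hit? t e) ⟧))
      ≡⟨ ∑-distribˡ es (suc κ) _ ⟨
    ∑ es (λ e → suc κ * ∑ ts (λ t → ⟦ does (hit? t e) ⟧)) ∎)
    where open ≤-Reasoning

  opaque
    -- A round leaves at most a fraction `κ / suc κ` of the targets. The inequality says that after
    -- `m` rounds fewer than one is left; for `m = 0` it forces `ts` to be empty.
    hittingSet : ∀ m ts → (∀ {t} → t ∈ ts → Popular t) → κ ^ m * length ts < suc κ ^ m →
      ∃ λ hs → length hs ≤ m × (∀ {t} → t ∈ ts → ∃ λ e → e ∈ hs × Hit t e)
    hittingSet zero    []       pop lt = [] , z≤n , λ ()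
    hittingSet zero    (t ∷ ts) pop (s≤s ())
    hittingSet (suc m) ts       pop lt with popular-element ts pop
    ... | e , _ , many with hittingSet m ts′ (pop ∘ ts′⊆ts) fewer
      where
      e? : ∀ t → Dec (Hit t e)
      e? t = hit? t e
      ts′ : List T
      ts′ = filter (¬? ∘ e?) ts
      ts′⊆ts : ts′ ⊆ ts
      ts′⊆ts = proj₁ ∘ ∈-filter⁻ (¬? ∘ e?)
      #hit : ℕ
      #hit = ∑ ts (λ t → ⟦ does (e? t) ⟧)
      split : length ts ≡ #hit + length ts′
      split = trans (↭-length (filter-++-↭ e? ts)) (trans (List.length-++ (filter e? ts))
                    (cong (_+ length ts′) (length-filter e? ts)))
      decrease : suc κ * length ts′ ≤ κ * length ts
      decrease = +-cancelˡ-≤ (suc κ * #hit) _ _ (begin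
        suc κ * #hit + suc κ * length ts′  ≡⟨ *-distribˡ-+ (suc κ) #hit (length ts′) ⟨
        suc κ * (#hit + length ts′)        ≡⟨ cong (suc κ *_) split ⟨
        length ts + κ * length ts          ≤⟨ +-monoˡ-≤ (κ * length ts) many ⟩
        suc κ * #hit + κ * length ts       ∎)
        where open ≤-Reasoning
      fewer : κ ^ m * length ts′ < suc κ ^ m
      fewer = *-cancelˡ-< (suc κ) _ _ (begin-strict
        suc κ * (κ ^ m * length ts′)   ≡⟨ solve 3 (λ a b c → a :* (b :* c) := b :* (a :* c)) refl (suc κ) (κ ^ m) (length ts′) ⟩
        κ ^ m * (suc κ * length ts′)   ≤⟨ *-monoʳ-≤ (κ ^ m) decrease ⟩
        κ ^ m * (κ * length ts)        ≡⟨ solve 3 (λ a b c → b :* (a :* c) := a :* b :* c) refl κ (κ ^ m) (length ts) ⟩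
        κ ^ suc m * length ts          <⟨ lt ⟩
        suc κ ^ suc m                  ∎)
        where open ≤-Reasoning
    ...   | hs , |hs|≤m , hits = e ∷ hs , s≤s |hs|≤m , hits′
      where
      hits′ : ∀ {t} → t ∈ ts → ∃ λ e′ → e′ ∈ e ∷ hs × Hit t e′
      hits′ {t} t∈ts with hit? t e
      ... | yes hit = e , here refl , hit
      ... | no ¬hit with hits (∈-filter⁺ (λ t → ¬? (hit? t e)) t∈ts ¬hit)
      ...   | e′ , e′∈ , hit = e′ , there e′∈ , hit

∑-indicator : ∀ {m} (i : Fin m) → ∑ (allFin m) (λ j → ⟦ does (i Fin.≟ j) ⟧) ≤ 1
∑-indicator {m} i = ≤-trans (≤-reflexive (sym (length-filter (i Fin.≟_) (allFin m))))
  (Unique-⊆-length {ys = [ i ]} (Unique.filter⁺ (i Fin.≟_) (Unique.allFin⁺ m))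
    (λ j∈ → here (sym (proj₂ (∈-filter⁻ (i Fin.≟_) {xs = allFin m} j∈)))))

tabulate-injective : ∀ {m} (f : Fin m → A) → Unique (tabulate f) → ∀ {i j} → f i ≡ f j → i ≡ j
tabulate-injective f u eq = Unique-⋃-index (subst Unique (sym (⋃-singleton f)) u) (here refl) (here eq)

-- Bounded-degree expanders

module _ {p q : ℕ} where

  _≟ₑ_ : DecidableEquality (Fin p × Fin q)
  _≟ₑ_ = ≡-dec Fin._≟_ Fin._≟_

  open DecMembership _≟ₑ_ using () renaming (_∈?_ to _∈ₑ?_)
  open DecMembership (Fin._≟_ {p}) using () renaming (_∈?_ to _∈ₚ?_)
  open DecMembership (Fin._≟_ {q}) using () renaming (_∈?_ to _∈ₛ?_)

  module _ (E : List (Fin p × Fin q)) where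

    adjacent? : ∀ U s → Dec (Any (λ x → (x , s) ∈ E) U)
    adjacent? U s = any? (λ x → (x , s) ∈ₑ? E) U

    Nbr : List (Fin p) → List (Fin q)
    Nbr U = filter (adjacent? U) (allFin q)

    Nbr-Unique : ∀ U → Unique (Nbr U)
    Nbr-Unique U = Unique.filter⁺ (adjacent? U) (Unique.allFin⁺ q)

    ∈-Nbr⁺ : ∀ {U x s} → x ∈ U → (x , s) ∈ E → s ∈ Nbr U
    ∈-Nbr⁺ {U} {x} {s} x∈U xs∈E = ∈-filter⁺ (adjacent? U) (∈-allFin s) (Any.map (λ { refl → xs∈E }) x∈U)

    ∈-Nbr⁻ : ∀ {U s} → s ∈ Nbr U → ∃ λ x → x ∈ U × (x , s) ∈ E
    ∈-Nbr⁻ {U} s∈ = find (proj₂ (∈-filter⁻ (adjacent? U) {xs = allFin q} s∈))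

    Nbr-mono : ∀ {U V} → U ⊆ V → length (Nbr U) ≤ length (Nbr V)
    Nbr-mono {U} {V} U⊆V = Unique-⊆-length (Nbr-Unique U)
      (λ s∈ → let _ , x∈ , xs∈E = ∈-Nbr⁻ s∈ in ∈-Nbr⁺ (U⊆V x∈) xs∈E)

    Nbr-++ : ∀ U V → length (Nbr (U ++ V)) ≤ length (Nbr U) + length (Nbr V)
    Nbr-++ U V = ≤-trans (Unique-⊆-length (Nbr-Unique (U ++ V)) sub) (≤-reflexive (List.length-++ (Nbr U)))
      where
      sub : Nbr (U ++ V) ⊆ Nbr U ++ Nbr V
      sub s∈ with ∈-Nbr⁻ s∈
      ... | x , x∈ , xs∈E with ∈-++⁻ U x∈
      ...   | inj₁ x∈U = ∈-++⁺ˡ (∈-Nbr⁺ x∈U xs∈E)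
      ...   | inj₂ x∈V = ∈-++⁺ʳ (Nbr U) (∈-Nbr⁺ x∈V xs∈E)

    LargeSetsExpand : ℕ → Set
    LargeSetsExpand u = ∀ U → Unique U → u ≤ length U → u + u ≤ length (Nbr U)

    SmallSetsExpand : ℕ → List (Fin p) → Set
    SmallSetsExpand u W = ∀ U → Unique U → Disjoint U W → length U ≤ u → length U ≤ length (Nbr U)

    -- W is a maximal set with |Nbr W| ≤ |W|; it stays below u because sets of size u expand.
    opaque
      deleteNonExpanding : ∀ u → 0 < u → LargeSetsExpand u → ∃ λ W → length W ≤ u × SmallSetsExpand u W
      deleteNonExpanding u 0<u large = go u [] [] (Nbr-empty) 0<u ≤-refl
        where
        open DecUnique (Fin._≟_ {p}) using (unique?)
        Nbr-empty : length (Nbr []) ≤ 0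
        Nbr-empty = Unique-⊆-length {ys = []} (Nbr-Unique []) (λ s∈ → case (∈-Nbr⁻ s∈))
          where case : ∀ {s} → (∃ λ x → x ∈ [] × (x , s) ∈ E) → s ∈ []
                case (_ , () , _)
        Extends : List (Fin p) → List (Fin p) → Set
        Extends W U = Unique (U ++ W) × length U ≤ u × length (Nbr U) < length U
        extends? : ∀ W U → Dec (Extends W U)
        extends? W U = unique? (U ++ W) ×-dec (length U ≤? u) ×-dec (length (Nbr U) <? length U)
        -- `W` stays below `u` elements, lacks at most `fuel` of reaching `u`, and grows with every
        -- extension, so the fuel cannot run out.
        go : ∀ fuel W → Unique W → length (Nbr W) ≤ length W → length W < u → u ≤ length W + fuel →
             ∃ λ W → length W ≤ u × SmallSetsExpand u W
        go zero W _ _ |W|<u le = contradiction (subst (u ≤_) (+-identityʳ _) le) (<⇒≱ |W|<u)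
        go (suc fuel) W W! NW |W|<u le with any? (extends? W) (subsets (allFin p))
        ... | yes some with find some
        ...   | U , _ , UW! , |U|≤u , NU =
            go fuel (U ++ W) UW! (<⇒≤ NUW) |UW|<u
               (≤-trans le (subst (λ l → length W + suc fuel ≤ l + fuel) (sym (List.length-++ U)) (begin
                 length W + suc fuel          ≡⟨ +-suc (length W) fuel ⟩
                 suc (length W) + fuel        ≤⟨ +-monoˡ-≤ fuel (+-monoˡ-≤ (length W) (≤-trans (s≤s z≤n) NU)) ⟩
                 length U + length W + fuel   ∎)))
          where
          open ≤-Reasoning
          NUW : length (Nbr (U ++ W)) < length (U ++ W)
          NUW = begin-strict
            length (Nbr (U ++ W))             ≤⟨ Nbr-++ U W ⟩
            length (Nbr U) + length (Nbr W)   <⟨ +-mono-<-≤ NU NW ⟩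
            length U + length W               ≡⟨ List.length-++ U ⟨
            length (U ++ W)                   ∎
          |UW|<u : length (U ++ W) < u
          -- Otherwise `U ++ W` would have at least `u + u` neighbours, but it has at most `u + u`
          -- elements and fewer neighbours than elements.
          |UW|<u = ≰⇒> λ u≤ → <⇒≱ NUW (begin
            length (U ++ W)        ≡⟨ List.length-++ U ⟩
            length U + length W    ≤⟨ +-mono-≤ |U|≤u (<⇒≤ |W|<u) ⟩
            u + u                  ≤⟨ large (U ++ W) UW! u≤ ⟩
            length (Nbr (U ++ W))  ∎)
        go (suc fuel) W W! NW |W|<u le | no none = W , <⇒≤ |W|<u , small
          where
          small : SmallSetsExpand u W
          -- The search ran over the sublists of `allFin p`, so a violating `U` is first put into
          -- that order.
          small U U! U#W |U|≤u = ≮⇒≥ λ NU → none (lose (filter∈subsets (_∈ₚ? U) (allFin p))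
              ( Unique.++⁺ Us! W! (λ (v∈ , v∈W) → U#W (sub v∈ , v∈W))
              , ≤-trans (Unique-⊆-length Us! sub) |U|≤u
              , ≤-trans (s≤s (Nbr-mono sub)) (≤-trans NU (Unique-⊆-length U! (λ {v} v∈ → ∈-filter⁺ (_∈ₚ? U) (∈-allFin v) v∈)))))
            where
            Us! : Unique (filter (_∈ₚ? U) (allFin p))
            Us! = Unique.filter⁺ (_∈ₚ? U) (Unique.allFin⁺ p)
            sub : filter (_∈ₚ? U) (allFin p) ⊆ U
            sub = proj₂ ∘ ∈-filter⁻ (_∈ₚ? U) {xs = allFin p}

  -- A possible failure of expansion: all neighbours of `U` lie in `C`. An edge that hits the target
  -- refutes it.
  Target : Set
  Target = List (Fin p) × List (Fin q)

  Hit : Target → Fin p × Fin q → Set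
  Hit (U , C) (x , s) = x ∈ U × ¬ (s ∈ C)

  hit? : ∀ t e → Dec (Hit t e)
  hit? (U , C) (x , s) = (x ∈ₚ? U) ×-dec ¬? (s ∈ₛ? C)

  inside : List (Fin p) → ℕ
  inside U = ∑ (allFin p) (λ x → ⟦ does (x ∈ₚ? U) ⟧)

  outside : List (Fin q) → ℕ
  outside C = ∑ (allFin q) (λ s → ⟦ does (¬? (s ∈ₛ? C)) ⟧)

  inside-≥ : ∀ {U V} → Unique U → U ⊆ V → length U ≤ inside V
  inside-≥ {U} {V} U! U⊆V = ≤-trans (Unique-⊆-length U! (λ {v} v∈ → ∈-filter⁺ (_∈ₚ? V) (∈-allFin v) (U⊆V v∈)))
    (≤-reflexive (length-filter (_∈ₚ? V) (allFin p)))

  outside-≥ : ∀ {C} → Unique C → q ≤ length C + outside C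
  outside-≥ {C} C! = begin
    q                              ≡⟨ List.length-tabulate (λ (i : Fin q) → i) ⟨
    length (allFin q)              ≡⟨ trans (↭-length (filter-++-↭ (_∈ₛ? C) (allFin q))) (List.length-++ (filter (_∈ₛ? C) (allFin q))) ⟩
    length (filter (_∈ₛ? C) (allFin q)) + length (filter (λ s → ¬? (s ∈ₛ? C)) (allFin q))
                                   ≤⟨ +-mono-≤ (Unique-⊆-length (Unique.filter⁺ (_∈ₛ? C) (Unique.allFin⁺ q))
                                                 (proj₂ ∘ ∈-filter⁻ (_∈ₛ? C) {xs = allFin q}))
                                               (≤-reflexive (length-filter (λ s → ¬? (s ∈ₛ? C)) (allFin q))) ⟩
    length C + outside C           ∎
    where open ≤-Reasoning

  ∑-hits : ∀ U C → ∑ (cartesianProduct (allFin p) (allFin q)) (λ e → ⟦ does (hit? (U , C) e) ⟧) ≡ inside U * outside C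
  ∑-hits U C = begin
    ∑ (cartesianProduct (allFin p) (allFin q)) (λ e → ⟦ does (hit? (U , C) e) ⟧)
      ≡⟨ ∑-cartesianProduct (allFin p) (allFin q) _ ⟩
    ∑ (allFin p) (λ x → ∑ (allFin q) (λ s → ⟦ does (x ∈ₚ? U) ∧ does (¬? (s ∈ₛ? C)) ⟧))
      ≡⟨ ∑-cong (allFin p) (λ x → trans (∑-cong (allFin q) (λ s → ⟦∧⟧ (does (x ∈ₚ? U)) _)) (∑-distribˡ (allFin q) ⟦ does (x ∈ₚ? U) ⟧ (λ s → ⟦ does (¬? (s ∈ₛ? C)) ⟧))) ⟩
    ∑ (allFin p) (λ x → ⟦ does (x ∈ₚ? U) ⟧ * outside C)
      ≡⟨ ∑-cong (allFin p) (λ x → *-comm ⟦ does (x ∈ₚ? U) ⟧ (outside C)) ⟩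
    ∑ (allFin p) (λ x → outside C * ⟦ does (x ∈ₚ? U) ⟧)
      ≡⟨ ∑-distribˡ (allFin p) (outside C) _ ⟩
    outside C * inside U
      ≡⟨ *-comm (outside C) (inside U) ⟩
    inside U * outside C ∎
    where
    open ≡-Reasoning
    ⟦∧⟧ : ∀ a b → ⟦ a ∧ b ⟧ ≡ ⟦ a ⟧ * ⟦ b ⟧
    ⟦∧⟧ true  b = sym (+-identityʳ ⟦ b ⟧)
    ⟦∧⟧ false b = refl

*-^ : ∀ m n k → (m * n) ^ k ≡ m ^ k * n ^ k
*-^ m n zero    = refl
*-^ m n (suc k) rewrite *-^ m n k =
  solve 4 (λ a b c d → a :* b :* (c :* d) := a :* c :* (b :* d)) refl m n (m ^ k) (n ^ k)

-- Thirteen rounds, each leaving at most 17/18 of the targets, more than halve their number. The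
-- case `j = 1` is checked by evaluation and then raised to the power `j`.
sparse-bound : ∀ j → 0 < j → 17 ^ (13 * j) * 2 ^ j < 18 ^ (13 * j)
sparse-bound j 0<j = begin-strict
  17 ^ (13 * j) * 2 ^ j      ≡⟨ cong (_* 2 ^ j) (^-*-assoc 17 13 j) ⟨
  (17 ^ 13) ^ j * 2 ^ j      ≡⟨ *-^ (17 ^ 13) 2 j ⟨
  (17 ^ 13 * 2) ^ j          <⟨ ^-monoˡ-< j {{>-nonZero 0<j}} (<ᵇ⇒< (17 ^ 13 * 2) (18 ^ 13) _) ⟩
  (18 ^ 13) ^ j              ≡⟨ ^-*-assoc 18 13 j ⟩
  18 ^ (13 * j)              ∎
  where open ≤-Reasoning

module _ {u p q : ℕ} (0<u : 0 < u) (p≡9u : p ≡ 9 * u) (q≡4u : q ≡ 4 * u) where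

  private
    Relevant : Target {p} {q} → Set
    Relevant (U , C) = u ≤ inside {q = q} U × u + u ≤ outside {p = p} C

    relevant? : ∀ t → Dec (Relevant t)
    relevant? (U , C) = (u ≤? inside {q = q} U) ×-dec (u + u ≤? outside {p = p} C)

    pairs = cartesianProduct (allFin p) (allFin q)
    candidates = cartesianProduct (subsets (allFin p)) (subsets (allFin q))
    targets = filter relevant? candidates

    length-pairs : length pairs ≡ p * q
    length-pairs = trans (length-cartesianProduct (allFin p) (allFin q))
      (cong₂ _*_ (List.length-tabulate (λ (i : Fin p) → i)) (List.length-tabulate (λ (i : Fin q) → i)))

    length-candidates : length candidates ≡ 2 ^ (13 * u)
    length-candidates = begin
      length candidates            ≡⟨ length-cartesianProduct (subsets (allFin p)) _ ⟩
      length (subsets (allFin p)) * length (subsets (allFin q))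
        ≡⟨ cong₂ _*_ (length-subsets (allFin p)) (length-subsets (allFin q)) ⟩
      2 ^ length (allFin p) * 2 ^ length (allFin q)
        ≡⟨ cong₂ (λ i j → 2 ^ i * 2 ^ j) (List.length-tabulate (λ (i : Fin p) → i)) (List.length-tabulate (λ (i : Fin q) → i)) ⟩
      2 ^ p * 2 ^ q                ≡⟨ ^-distribˡ-+-* 2 p q ⟨
      2 ^ (p + q)                  ≡⟨ cong (2 ^_) (trans (cong₂ _+_ p≡9u q≡4u) (sym (*-distribʳ-+ u 9 4))) ⟩
      2 ^ (13 * u)                 ∎
      where open ≡-Reasoning

    open HittingSet (hit? {p} {q}) 17 pairs
      (subst (0 <_) (sym length-pairs) (*-mono-< {0} {p} {0} {q}
        (subst (0 <_) (sym p≡9u) (*-mono-≤ {1} {9} (s≤s z≤n) 0<u))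
        (subst (0 <_) (sym q≡4u) (*-mono-≤ {1} {4} (s≤s z≤n) 0<u))))

    popular : ∀ {t} → t ∈ targets → Popular t
    popular {U , C} t∈ with ∈-filter⁻ relevant? {xs = candidates} t∈
    ... | _ , u≤in , 2u≤out = begin
      length pairs                  ≡⟨ length-pairs ⟩
      p * q                         ≡⟨ cong₂ _*_ p≡9u q≡4u ⟩
      9 * u * (4 * u)               ≡⟨ solve 1 (λ u → con 9 :* u :* (con 4 :* u) := con 18 :* (u :* (u :+ u))) refl u ⟩
      18 * (u * (u + u))            ≤⟨ *-monoʳ-≤ 18 (*-mono-≤ u≤in 2u≤out) ⟩
      18 * (inside {q = q} U * outside {p = p} C)  ≡⟨ cong (18 *_) (∑-hits U C) ⟨
      18 * ∑ pairs (λ e → ⟦ does (hit? (U , C) e) ⟧) ∎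
      where open ≤-Reasoning

  -- A relevant (U , C) is hit by a fraction u * 2u / (9u * 4u) = 1/18 of the pairs, and 2 * 17 ^ 13 < 18 ^ 13.
  opaque
    largeSetsExpander : ∃ λ E → length E ≤ 169 * u × LargeSetsExpand {p} {q} E u
    -- There are at most `2 ^ (13 * u)` targets because `p + q` is `13 * u`; thirteen rounds for
    -- each factor of two make `169 * u` edges.
    largeSetsExpander = finish (hittingSet (13 * (13 * u)) targets popular (begin-strict
        17 ^ (13 * (13 * u)) * length targets  ≤⟨ *-monoʳ-≤ (17 ^ (13 * (13 * u)))
            (≤-trans (List.length-filter relevant? candidates) (≤-reflexive length-candidates)) ⟩
        17 ^ (13 * (13 * u)) * 2 ^ (13 * u)    <⟨ sparse-bound (13 * u) (*-mono-≤ {1} {13} (s≤s z≤n) 0<u) ⟩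
        18 ^ (13 * (13 * u))                   ∎))
      where
      open ≤-Reasoning
      open DecMembership (Fin._≟_ {p}) using () renaming (_∈?_ to _∈ₚ?_)
      large : ∀ {E} → (∀ {t} → t ∈ targets → ∃ λ e → e ∈ E × Hit t e) → LargeSetsExpand E u
      large {E} hits U U! u≤|U| = ≮⇒≥ λ N<2u → case N<2u
        where
        U′ : List (Fin p)
        U′ = filter (_∈ₚ? U) (allFin p)
        case : ¬ (length (Nbr E U) < u + u)
        -- If `U` had fewer than `2u` neighbours, more than `2u` of the `4u` points would lie
        -- outside them and the target would be relevant. An edge hitting it leads from `U` to a
        -- point that is no neighbour of `U`.
        case N<2u with hits {U′ , Nbr E U} (∈-filter⁺ relevant?
              (∈-cartesianProduct⁺ (filter∈subsets (_∈ₚ? U) (allFin p)) (filter∈subsets (adjacent? E U) (allFin q)))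
              ( ≤-trans u≤|U| (inside-≥ {q = q} {V = U′} U! (λ {v} v∈ → ∈-filter⁺ (_∈ₚ? U) (∈-allFin v) v∈))
              , +-cancelˡ-≤ (length (Nbr E U)) _ _ (begin
                  length (Nbr E U) + (u + u)   ≤⟨ +-monoˡ-≤ (u + u) (<⇒≤ N<2u) ⟩
                  u + u + (u + u)              ≡⟨ solve 1 (λ u → u :+ u :+ (u :+ u) := con 4 :* u) refl u ⟩
                  4 * u                        ≡⟨ q≡4u ⟨
                  q                        ≤⟨ outside-≥ {p = p} (Nbr-Unique E U) ⟩
                  length (Nbr E U) + outside {p = p} (Nbr E U) ∎)))
        ... | (x , s) , e∈E , x∈U′ , s∉N = s∉N (∈-Nbr⁺ E (proj₂ (∈-filter⁻ (_∈ₚ? U) {xs = allFin p} x∈U′)) e∈E)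
      finish : (∃ λ E → length E ≤ 13 * (13 * u) × (∀ {t} → t ∈ targets → ∃ λ e → e ∈ E × Hit t e)) →
               ∃ λ E → length E ≤ 169 * u × LargeSetsExpand {p} {q} E u
      finish (E , |E|≤ , hits) = E , ≤-trans |E|≤ (≤-reflexive (sym (*-assoc 13 13 u))) , large hits

-- inj₁ s is the slot initially matched to the point s; the slots inj₂ i belong to the flexible vertices.
Slot : ℕ → Set
Slot q = Fin q ⊎ Fin q

-- `nb s` lists the expander edges at the point `s`, and `few` keeps the total size of the gadgets
-- linear in `u`. The set `N` in `expands` witnesses Hall's condition for small sets of slots.
record Template (u q : ℕ) : Set where
  field
    nb      : Fin q → List (Slot q)
    few     : ∑ (allFin q) (length ∘ nb) ≤ 169 * u
    expands : ∀ R → Unique R → length R ≤ u →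
              ∃ λ N → Unique N × length R ≤ length N × (∀ {s} → s ∈ N → ∃ λ r → r ∈ R × r ∈ nb s)

opaque
  -- `2q` vertices outside `W` are renamed as slots by `ι`; its partial inverse `decode` drops the
  -- edges at all other vertices. The image of a set of slots avoids `W`, so it still expands.
  restrict : ∀ {u p q} (E : List (Fin p × Fin q)) (W : List (Fin p)) → length E ≤ 169 * u →
             SmallSetsExpand E u W → length W + (q + q) ≤ p → Template u q
  restrict {u} {p} {q} E W |E|≤ small room with avoid Fin._≟_ (allFin p) W (q + q) (Unique.allFin⁺ p)
      (subst (length W + (q + q) ≤_) (sym (List.length-tabulate (λ (i : Fin p) → i))) room)
  ... | Z , Z! , _ , Z#W , |Z| with untabulate Z |Z|
  ...   | g , refl = record { nb = nb ; few = few ; expands = expands }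
    where
    ι : Slot q → Fin p
    ι = g ∘ Fin.join q q
    ι-injective : ∀ {i j} → ι i ≡ ι j → i ≡ j
    ι-injective {i} {j} eq = trans (sym (Fin.splitAt-join q q i))
      (trans (cong (Fin.splitAt q) (tabulate-injective g Z! eq)) (Fin.splitAt-join q q j))
    decode : Fin p → Maybe (Slot q)
    decode x with Fin.any? (λ i → g i Fin.≟ x)
    ... | yes (i , _) = just (Fin.splitAt q i)
    ... | no _        = nothing
    decode-ι : ∀ i → decode (ι i) ≡ just i
    decode-ι i with Fin.any? (λ j → g j Fin.≟ ι i)
    ... | yes (j , eq) = cong just (trans (cong (Fin.splitAt q) (tabulate-injective g Z! eq)) (Fin.splitAt-join q q i))
    ... | no none      = contradiction (_ , refl) none
    edgesAt : Fin q → List (Fin p × Fin q)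
    edgesAt s = filter (λ e → proj₂ e Fin.≟ s) E
    nb : Fin q → List (Slot q)
    nb s = mapMaybe (decode ∘ proj₁) (edgesAt s)
    few : ∑ (allFin q) (length ∘ nb) ≤ 169 * u
    few = begin
      ∑ (allFin q) (length ∘ nb)       ≤⟨ ∑-mono (allFin q) (λ {s} _ → List.length-mapMaybe (decode ∘ proj₁) (edgesAt s)) ⟩
      ∑ (allFin q) (length ∘ edgesAt)  ≡⟨ ∑-cong (allFin q) (λ s → length-filter (λ e → proj₂ e Fin.≟ s) E) ⟩
      ∑ (allFin q) (λ s → ∑ E (λ e → ⟦ does (proj₂ e Fin.≟ s) ⟧))
                                       ≡⟨ ∑-swap (allFin q) E (λ s e → ⟦ does (proj₂ e Fin.≟ s) ⟧) ⟩
      ∑ E (λ e → ∑ (allFin q) (λ s → ⟦ does (proj₂ e Fin.≟ s) ⟧))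
                                       ≤⟨ ∑-bounded E _ (λ e → ∑-indicator (proj₂ e)) ⟩
      length E                         ≤⟨ |E|≤ ⟩
      169 * u                          ∎
      where open ≤-Reasoning
    ∈-nb : ∀ {i s} → (ι i , s) ∈ E → i ∈ nb s
    ∈-nb {i} {s} e∈E = Any.mapMaybe⁺ (decode ∘ proj₁) (edgesAt s)
      (lose (∈-map⁺ (decode ∘ proj₁) (∈-filter⁺ (λ e → proj₂ e Fin.≟ s) e∈E refl))
            (subst (Maybe.Any (i ≡_)) (sym (decode-ι i)) (Maybe.just refl)))
    expands : ∀ R → Unique R → length R ≤ u →
              ∃ λ N → Unique N × length R ≤ length N × (∀ {s} → s ∈ N → ∃ λ r → r ∈ R × r ∈ nb s)
    expands R R! |R|≤u = Nbr E (map ι R) , Nbr-Unique E (map ι R) ,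
      subst (_≤ length (Nbr E (map ι R))) (List.length-map ι R)
        (small (map ι R) (Unique.map⁺ ι-injective R!) disjoint (subst (_≤ u) (sym (List.length-map ι R)) |R|≤u)) ,
      adjacent
      where
      disjoint : Disjoint (map ι R) W
      disjoint (v∈ , v∈W) with ∈-map⁻ ι v∈
      ... | r , _ , refl = Z#W (∈-tabulate⁺ (Fin.join q q r) , v∈W)
      adjacent : ∀ {s} → s ∈ Nbr E (map ι R) → ∃ λ r → r ∈ R × r ∈ nb s
      adjacent s∈ with ∈-Nbr⁻ E s∈
      ... | x , x∈ , e∈E with ∈-map⁻ ι x∈
      ...   | r , r∈R , refl = r , r∈R , ∈-nb e∈E

opaque
  -- Of `9u` vertices at most `u` are deleted, which leaves `8u` slots, two for each of the `4u`
  -- points.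
  template : ∀ {u q} → 0 < u → q ≡ 4 * u → Template u q
  template {u} {q} 0<u q≡4u = build (9 * u) refl
    where
    build : ∀ p → p ≡ 9 * u → Template u q
    build p p≡9u =
      let E , |E|≤ , large   = largeSetsExpander 0<u p≡9u q≡4u
          W , |W|≤u , small = deleteNonExpanding E u 0<u large
      in restrict E W |E|≤ small (begin
        length W + (q + q)         ≤⟨ +-monoˡ-≤ (q + q) |W|≤u ⟩
        u + (q + q)                ≡⟨ cong (λ q → u + (q + q)) q≡4u ⟩
        u + (4 * u + 4 * u)        ≡⟨ solve 1 (λ u → u :+ (con 4 :* u :+ con 4 :* u) := con 9 :* u) refl u ⟩
        9 * u                      ≡⟨ p≡9u ⟨
        p                          ∎)
      where open ≤-Reasoning

-- Exchange along alternating paths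

updateAt-↭ : ∀ {m} (f : Fin m → A) i x → f i ∷ tabulate (updateAt f i (const x)) ↭ x ∷ tabulate f
updateAt-↭ f zero    x = swap _ _ ↭-refl
updateAt-↭ f (suc i) x = ↭-trans (swap _ _ ↭-refl) (↭-trans (prep _ (updateAt-↭ (f ∘ suc) i x)) (swap _ _ ↭-refl))

module Exchange {u q} (𝒯 : Template u q) where
  open Template 𝒯
  open DecMembership (Sum.≡-dec (Fin._≟_ {q}) (Fin._≟_ {q})) using (_∈?_)

  -- The initial slot is always allowed at its point, whether or not the expander contains that
  -- edge.
  Valid : (Fin q → Slot q) → Set
  Valid m = ∀ s → m s ≡ inj₁ s ⊎ m s ∈ nb s

  -- The slots reachable from y by alternating paths; a matching leaving out r may differ from m
  -- only where m takes a slot already reached.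
  opaque
    exchange : ∀ m y → Valid m → Unique (y ∷ tabulate m) →
               ∃ λ R → Unique R × length R ≡ suc u ×
                 (∀ {r} → r ∈ R → ∃ λ m′ → Valid m′ × r ∷ tabulate m′ ↭ y ∷ tabulate m)
    exchange m y valid ym!@(y∉m ∷ m!) with grow u ≤-refl
      where
      Leaves : List (Slot q) → Slot q → Set
      Leaves R r = ∃ λ m′ → Valid m′ × r ∷ tabulate m′ ↭ y ∷ tabulate m × (∀ s → m s ∉ R → m′ s ≡ m s)
      grow : ∀ k → k ≤ u → ∃ λ R → Unique R × y ∈ R × length R ≡ suc k × (∀ {r} → r ∈ R → Leaves R r)
      grow zero    _   = [ y ] , [] ∷ [] , here refl , refl , λ { (here refl) → m , valid , ↭-refl , λ _ _ → refl }
      grow (suc k) k<u with grow k (<⇒≤ k<u)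
      ... | R , R! , y∈R , |R| , leaves with expands R R! (subst (_≤ u) (sym |R|) k<u)
      ...   | N , N! , |R|≤|N| , adj with any? (λ s → ¬? (m s ∈? R)) N
      -- If `m` took only slots of `R` at the points of `N`, these slots and `y`, all distinct,
      -- would be more than `length R` elements of `R`.
      ...     | no none = contradiction
        (subst (λ l → suc l ≤ length R) (List.length-map m N) (Unique-⊆-length yN! yN⊆R)) (≤⇒≯ |R|≤|N|)
        where
        yN! : Unique (y ∷ map m N)
        yN! = All.tabulate (λ v∈ → λ { refl → let s , _ , eq = ∈-map⁻ m v∈ in
                All.lookup y∉m (subst (_∈ tabulate m) (sym eq) (∈-tabulate⁺ s)) refl })
              ∷ Unique.map⁺ (tabulate-injective m m!) N!
        in-R : ∀ {s} → s ∈ N → m s ∈ R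
        in-R {s} s∈ with m s ∈? R
        ... | yes p = p
        ... | no ¬p = contradiction (lose s∈ ¬p) none
        yN⊆R : y ∷ map m N ⊆ R
        yN⊆R (here refl) = y∈R
        yN⊆R (there v∈) with ∈-map⁻ m v∈
        ... | s , s∈ , refl = in-R s∈
      ...     | yes some with find some
      ...       | s , s∈N , ms∉R with adj s∈N
      ...         | r , r∈R , r∈nb with leaves r∈R
      ...           | m′ , valid′ , perm , same =
        m s ∷ R , All.tabulate (λ v∈ → λ { refl → ms∉R v∈ }) ∷ R! , there y∈R , cong suc |R| , leaves′
        where
        -- The assignment `m′` leaving out `r` agrees with `m` at `s`, because `m s` was not yet
        -- reached. Putting `r` at `s` therefore leaves out `m s` instead.
        m″ : Fin q → Slot q
        m″ = updateAt m′ s (const r)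
        valid″ : Valid m″
        valid″ t with t Fin.≟ s
        ... | yes refl rewrite updateAt-updates s {const r} m′ = inj₂ r∈nb
        ... | no t≢s rewrite updateAt-minimal t s {const r} m′ t≢s = valid′ t
        leaves′ : ∀ {r′} → r′ ∈ m s ∷ R → Leaves (m s ∷ R) r′
        leaves′ (here refl) = m″ , valid″ ,
          ↭-trans (subst (λ v → v ∷ tabulate m″ ↭ r ∷ tabulate m′) (same s ms∉R) (updateAt-↭ m′ s r)) perm ,
          λ t mt∉ → trans (updateAt-minimal t s {const r} m′ (λ { refl → mt∉ (here refl) })) (same t (mt∉ ∘ there))
        leaves′ (there r′∈) with leaves r′∈
        ... | m‴ , v , p , same′ = m‴ , v , p , λ t mt∉ → same′ t (mt∉ ∘ there)
    ... | R , R! , _ , |R| , leaves = R , R! , |R| , λ r∈ → let m′ , v , p , _ = leaves r∈ in m′ , v , p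

-- Tilings by copies of H

does-≟true : ∀ b → does (b Bool.≟ true) ≡ b
does-≟true true  = refl
does-≟true false = refl

∑-tabulate : ∀ {m} (g : Fin m → A) (f : A → Bool) → ∑ (tabulate g) (⟦_⟧ ∘ f) ≡ Subset.∣ Vec.tabulate (f ∘ g) ∣
∑-tabulate {m = zero}  g f = refl
∑-tabulate {m = suc m} g f with f (g zero)
... | true  = cong suc (∑-tabulate (g ∘ suc) f)
... | false = ∑-tabulate (g ∘ suc) f

opaque
  injective⇒surjective : ∀ {m} (σ : Fin m → Fin m) → Injective _≡_ _≡_ σ → ∀ i → ∃ λ j → σ j ≡ i
  injective⇒surjective {m} σ σ-inj i with ∈-tabulate⁻ (∈-resp-↭ (↭-sym σ↭) (∈-allFin i))
    where
    σ↭ : tabulate σ ↭ allFin m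
    σ↭ = Unique-⊆-↭ (Unique.tabulate⁺ σ-inj) (λ {v} _ → ∈-allFin v)
           (≤-reflexive (trans (List.length-tabulate (λ (i : Fin m) → i)) (sym (List.length-tabulate σ))))
  ... | j , eq = j , sym eq

module _ {n : ℕ} where
  open DecMembership (Fin._≟_ {n}) using (_∈?_)

  toSubset : List (Fin n) → Subset.Subset n
  toSubset xs = Vec.tabulate (λ v → does (v ∈? xs))

  ∈-toSubset⁻ : ∀ {v} xs → v Subset.∈ toSubset xs → v ∈ xs
  ∈-toSubset⁻ {v} xs v∈ with trans (sym (Vec.lookup∘tabulate (λ v → does (v ∈? xs)) v)) (Vec.[]=⇒lookup v∈)
  ... | eq with v ∈? xs
  ...   | yes v∈xs = v∈xs

  ∣toSubset∣ : ∀ {xs} → Unique xs → length xs ≤ Subset.∣ toSubset xs ∣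
  ∣toSubset∣ {xs} xs! = begin
    length xs                                     ≤⟨ Unique-⊆-length xs! (λ {v} v∈ → ∈-filter⁺ (_∈? xs) (∈-allFin v) v∈) ⟩
    length (filter (_∈? xs) (allFin n))           ≡⟨ length-filter (_∈? xs) (allFin n) ⟩
    ∑ (allFin n) (λ v → ⟦ does (v ∈? xs) ⟧)       ≡⟨ ∑-tabulate (λ v → v) (λ v → does (v ∈? xs)) ⟩
    Subset.∣ toSubset xs ∣                        ∎
    where open ≤-Reasoning

module Tiling {k n : ℕ} (H : Graph (suc k)) (G : Graph n) where

  private
    h : ℕ
    h = suc k
    V : Set
    V = Fin n

  Adj-sym : ∀ {u v} → Adj G u v → Adj G v u
  Adj-sym {u} {v} uv = trans (Graph.sym G v u) uv

  Adj-irrefl : ∀ {u v} → Adj G u v → u ≢ v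
  Adj-irrefl {u} uv refl with trans (sym uv) (Graph.irrfl G u)
  ... | ()

  Tile : List V → Set
  Tile xs = ∃ λ φ → IsCopy H G φ × tabulate φ ↭ xs

  Tile-length : Tile xs → length xs ≡ h
  Tile-length (φ , _ , p) = trans (sym (↭-length p)) (List.length-tabulate φ)

  Tile-Unique : Tile xs → Unique xs
  Tile-Unique (φ , (inj , _) , p) = Unique-resp-↭ p (Unique.tabulate⁺ inj)

  -- Disjointness of the tiles is not recorded; it follows once the whole list is known to be free
  -- of repetitions. `resp` makes the order of the vertices irrelevant.
  data Tiled : List V → Set where
    []   : Tiled []
    cons : Tile xs → Tiled ys → Tiled (xs ++ ys)
    resp : xs ↭ ys → Tiled xs → Tiled ys

  Tiled-++ : Tiled xs → Tiled ys → Tiled (xs ++ ys)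
  Tiled-++ []           q = q
  Tiled-++ {ys = zs} (cons {xs} {ys} t p) q = resp (↭-sym (Perm.++-assoc xs ys zs)) (cons t (Tiled-++ p q))
  Tiled-++ (resp r p)   q = resp (Perm.++⁺ʳ _ r) (Tiled-++ p q)

  tile : Tile xs → Tiled xs
  tile {xs} t = resp (Perm.++-identityʳ xs) (cons t [])

  Tiled-⋃ : ∀ {m} {F : Fin m → List V} → (∀ i → Tiled (F i)) → Tiled (⋃ F)
  Tiled-⋃ {zero}  p = []
  Tiled-⋃ {suc m} p = Tiled-++ (p zero) (Tiled-⋃ (p ∘ suc))

  Tiled-length : Tiled xs → h ∣ length xs
  Tiled-length []                 = h ∣0
  Tiled-length (cons {xs} {ys} t p) = subst (h ∣_) (sym (trans (List.length-++ xs) (cong (_+ length ys) (Tile-length t))))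
                                        (∣m∣n⇒∣m+n ∣-refl (Tiled-length p))
  Tiled-length (resp r p)         = subst (h ∣_) (↭-length r) (Tiled-length p)

  opaque
    copies : Tiled xs → ∃₂ λ m (φ : Fin m → Fin h → V) → (∀ i → IsCopy H G (φ i)) × ⋃ (tabulate ∘ φ) ↭ xs
    copies []         = 0 , (λ ()) , (λ ()) , ↭-refl
    copies (cons (φ₀ , c , p) t) with copies t
    ... | m , φ , cs , q = suc m , φ′ , cs′ , Perm.++⁺ p q
      where
      φ′ : Fin (suc m) → Fin h → V
      φ′ zero    = φ₀
      φ′ (suc i) = φ i
      cs′ : ∀ i → IsCopy H G (φ′ i)
      cs′ zero    = c
      cs′ (suc i) = cs i
    copies (resp r t) with copies t
    ... | m , φ , cs , q = m , φ , cs , ↭-trans q r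

  Tiled⇒HFactor : Tiled (allFin n) → HFactor H G
  Tiled⇒HFactor t with copies t
  ... | m , φ , cs , p = m , φ , cs ,
      (λ i i′ j j′ eq → Unique-⋃-index {F = tabulate ∘ φ} (Unique-resp-↭ (↭-sym p) (Unique.allFin⁺ n))
                          (∈-tabulate⁺ {f = φ i} j) (subst (_∈ tabulate (φ i′)) (sym eq) (∈-tabulate⁺ {f = φ i′} j′))) ,
      covered
    where
    covered : ∀ v → ∃₂ λ i j → φ i j ≡ v
    covered v with ∈-concat⁻′ (tabulate (tabulate ∘ φ)) (∈-resp-↭ (↭-sym p) (∈-allFin v))
    ... | xs , v∈xs , xs∈ with ∈-tabulate⁻ {f = tabulate ∘ φ} xs∈
    ...   | i , refl with ∈-tabulate⁻ {f = φ i} v∈xs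
    ...     | j , eq = i , j , sym eq

  -- `σ` is injective on a finite set, so `ψ ∘ σ` runs through the same vertices as `ψ`.
  permutedCopy : ∀ {σ : Fin h → Fin h} → Injective _≡_ _≡_ σ → ∀ (ψ : Fin h → V) → Injective _≡_ _≡_ ψ →
                 (∀ i j → Adj H i j → Adj G (ψ (σ i)) (ψ (σ j))) → Tile (tabulate ψ)
  permutedCopy {σ} σ-inj ψ ψ-inj pres = ψ ∘ σ , (σ-inj ∘ ψ-inj , pres) ,
    Unique-⊆-↭ (Unique.tabulate⁺ {f = ψ ∘ σ} (σ-inj ∘ ψ-inj))
      (λ v∈ → let i , eq = ∈-tabulate⁻ {f = ψ ∘ σ} v∈ in subst (_∈ tabulate ψ) (sym eq) (∈-tabulate⁺ {f = ψ} (σ i)))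
      (≤-reflexive (trans (List.length-tabulate ψ) (sym (List.length-tabulate (ψ ∘ σ)))))

  module _ {a : ℕ} (α : AlphaProp H G a) where

    opaque
      -- `AlphaProp` matches the vertices of `H` with the parts by some `σ`; `ψ` lists the copy by
      -- parts. A vertex `v` joined to the vertices chosen in all other parts may replace the one in
      -- part `zero`, whichever vertex of `H` that represents.
      transversal : ∀ (F : Fin h → List V) → Unique (⋃ F) → (∀ i → a ≤ length (F i)) →
        ∃ λ ψ → (∀ i → ψ i ∈ F i) × Tile (tabulate ψ) ×
                (∀ v → (∀ i → Adj G v (ψ (suc i))) → Tile (v ∷ tabulate (ψ ∘ suc)))
      transversal F F! a≤ with α (toSubset ∘ F)
          (λ i j v v∈ v∈′ → Unique-⋃-index F! (∈-toSubset⁻ (F i) v∈) (∈-toSubset⁻ (F j) v∈′))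
          (λ i → ≤-trans (a≤ i) (∣toSubset∣ (Unique-⋃⁻ {F = F} F! i)))
      ... | σ , σ-inj , φ , φ∈ , φ-inj , φ-pres = ψ , ψ∈ , permutedCopy σ-inj ψ ψ-inj ψ-pres , replaceHead
        where
        τ : Fin h → Fin h
        τ i = proj₁ (injective⇒surjective σ σ-inj i)
        στ : ∀ i → σ (τ i) ≡ i
        στ i = proj₂ (injective⇒surjective σ σ-inj i)
        ψ : Fin h → V
        ψ = φ ∘ τ
        ψσ : ∀ j → ψ (σ j) ≡ φ j
        ψσ j = cong φ (σ-inj (στ (σ j)))
        ψ∈ : ∀ i → ψ i ∈ F i
        ψ∈ i = ∈-toSubset⁻ (F i) (subst (λ j → ψ i Subset.∈ toSubset (F j)) (στ i) (φ∈ (τ i)))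
        ψ-inj : Injective _≡_ _≡_ ψ
        ψ-inj {i} {j} eq = trans (sym (στ i)) (trans (cong σ (φ-inj eq)) (στ j))
        ψ-pres : ∀ i j → Adj H i j → Adj G (ψ (σ i)) (ψ (σ j))
        ψ-pres i j ij = subst₂ (Adj G) (sym (ψσ i)) (sym (ψσ j)) (φ-pres i j ij)
        replaceHead : ∀ v → (∀ i → Adj G v (ψ (suc i))) → Tile (v ∷ tabulate (ψ ∘ suc))
        -- An edge of `H` has distinct ends, so at most one of them is represented by `v`.
        replaceHead v v-adj = permutedCopy σ-inj ψ′ ψ′-inj
            (λ i j ij → pres (σ i) (σ j) (λ eq → H-irrefl (trans (cong (λ l → adj H i l) (σ-inj eq)) ij)) (ψ-pres i j ij))
          where
          H-irrefl : ∀ {i} → ¬ (Adj H i i)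
          H-irrefl {i} ii with trans (sym ii) (Graph.irrfl H i)
          ... | ()
          ψ′ : Fin h → V
          ψ′ zero    = v
          ψ′ (suc i) = ψ (suc i)
          ψ′-inj : Injective _≡_ _≡_ ψ′
          ψ′-inj {zero}  {zero}  eq = refl
          ψ′-inj {zero}  {suc j} eq = contradiction eq (Adj-irrefl (v-adj j))
          ψ′-inj {suc i} {zero}  eq = contradiction (sym eq) (Adj-irrefl (v-adj i))
          ψ′-inj {suc i} {suc j} eq = ψ-inj eq
          pres : ∀ i j → i ≢ j → Adj G (ψ i) (ψ j) → Adj G (ψ′ i) (ψ′ j)
          pres zero    zero    i≢j _ = contradiction refl i≢j
          pres zero    (suc j) _   _ = v-adj j
          pres (suc i) zero    _   _ = Adj-sym (v-adj i)
          pres (suc i) (suc j) _   p = p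

    -- p and v are interchangeable: S completes either of them to a copy of H.
    opaque
      switch : ∀ v P A → Unique (P ++ A) → (∀ {w} → w ∈ A → Adj G v w) → k * a ≤ length A → a ≤ length P →
               ∃₂ λ p S → p ∈ P × S ⊆ A × Tile (p ∷ S) × Tile (v ∷ S)
      switch v P A PA! v-adj ka≤ a≤ =
        let F , rest , |F| , F≡ = chunks k a A ka≤
            F⊆A : ⋃ F ⊆ A
            F⊆A = λ w∈ → subst (_ ∈_) F≡ (∈-++⁺ˡ w∈)
            PF! : Unique (P ++ ⋃ F)
            PF! = Unique-++⁻ˡ (P ++ ⋃ F) (subst Unique (trans (cong (P ++_) (sym F≡)) (sym (List.++-assoc P (⋃ F) rest))) PA!)
            ψ , ψ∈ , t , replaceHead = transversal (P ◂ F) PF!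
              (λ { zero → a≤ ; (suc i) → ≤-reflexive (sym (|F| i)) })
            inA = λ i → F⊆A (∈-⋃ {F = F} i (ψ∈ (suc i)))
        in ψ zero , tabulate (ψ ∘ suc) , ψ∈ zero ,
           (λ w∈ → let i , eq = ∈-tabulate⁻ {f = ψ ∘ suc} w∈ in subst (_∈ A) (sym eq) (inA i)) ,
           t , replaceHead v (v-adj ∘ inA)

    opaque
      -- `switch` within one neighbourhood: the first `a` vertices of `A` serve as the candidates
      -- `P`, and only the tile through `v` is kept.
      cover : ∀ v A → Unique A → (∀ {w} → w ∈ A → Adj G v w) → h * a ≤ length A → ∃ λ S → S ⊆ A × Tile (v ∷ S)
      cover v A A! v-adj ha≤ =
        let _ , S , _ , S⊆ , _ , t = switch v (take a A) (drop a A)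
              (subst Unique (sym (List.take++drop≡id a A)) A!) (v-adj ∘ drop-⊆ a A)
              (subst (k * a ≤_) (sym (List.length-drop a A)) (subst (_≤ length A ∸ a) (m+n∸m≡n a (k * a)) (∸-monoˡ-≤ a ha≤)))
              (≤-reflexive (sym (length-take-≤ a A (≤-trans (m≤m+n a (k * a)) ha≤))))
        in S , drop-⊆ a A ∘ S⊆ , t

    opaque
      freeTile : ∀ A → Unique A → h * a ≤ length A → ∃ λ S → S ⊆ A × Tile S
      freeTile A A! ha≤ =
        let F , rest , |F| , F≡ = chunks h a A ha≤
            ψ , ψ∈ , t , _ = transversal F (Unique-++⁻ˡ (⋃ F) (subst Unique (sym F≡) A!)) (λ i → ≤-reflexive (sym (|F| i)))
        in tabulate ψ ,
           (λ w∈ → let i , eq = ∈-tabulate⁻ {f = ψ} w∈ in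
                   subst (_∈ A) (sym eq) (subst (ψ i ∈_) F≡ (∈-++⁺ˡ (∈-⋃ {F = F} i (ψ∈ i))))) ,
           t

    opaque
      peel : ∀ B → Unique B → h * a ≤ length B → ∃₂ λ S B′ → Tile S × B ↭ S ++ B′ × length B′ < length B
      peel B B! ha≤ with freeTile B B! ha≤
      ... | S , S⊆B , t with complement (Tile-Unique t) S⊆B
      ...   | B′ , B↭ = S , B′ , t , B↭ , (begin
        suc (length B′)          ≤⟨ +-monoˡ-≤ (length B′) (s≤s z≤n) ⟩
        h + length B′            ≡⟨ cong (_+ length B′) (Tile-length t) ⟨
        length S + length B′     ≡⟨ List.length-++ S ⟨
        length (S ++ B′)         ≡⟨ ↭-length B↭ ⟨
        length B                 ∎)
        where open ≤-Reasoning

    Remainder : List V → Set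
    Remainder B = ∃₂ λ T L → B ↭ T ++ L × Tiled T × length L ≤ h * a

    Remainder-++ : ∀ {B S B′} → Tile S → B ↭ S ++ B′ → Remainder B′ → Remainder B
    Remainder-++ {S = S} t B↭ (T , L , B′↭ , tiled , small) =
      S ++ T , L , ↭-trans B↭ (↭-trans (Perm.++⁺ˡ S B′↭) (↭-sym (Perm.++-assoc S T L))) , cons t tiled , small

    opaque
      greedy : ∀ B → Unique B → Remainder B
      greedy B B! = go (length B) B B! ≤-refl
        where
        go : ∀ fuel B → Unique B → length B ≤ fuel → Remainder B
        go zero    B B! le = [] , B , ↭-refl , [] , ≤-trans le z≤n
        go (suc f) B B! le with h * a ≤? length B
        ... | no ha≰  = [] , B , ↭-refl , [] , <⇒≤ (≰⇒> ha≰)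
        ... | yes ha≤ with peel B B! ha≤
        ...   | S , B′ , t , B↭ , shorter =
          Remainder-++ t B↭ (go f B′ (Unique-++⁻ʳ S (Unique-resp-↭ B↭ B!)) (≤-pred (≤-trans shorter le)))

-- Gadgets

Fresh : List A → List A → Set
Fresh K F = Unique K × Disjoint K F

Fresh-++ : ∀ {K M F : List A} → Fresh K F → Fresh M (K ++ F) → Fresh (K ++ M) F
Fresh-++ {K = K} {M} {F} (K! , K#F) (M! , M#KF) =
  Unique.++⁺ K! M! (λ (v∈K , v∈M) → M#KF (v∈M , ∈-++⁺ˡ v∈K)) ,
  λ (v∈KM , v∈F) → either v∈F (∈-++⁻ K v∈KM)
  where
  either : ∀ {v} → v ∈ F → v ∈ K ⊎ v ∈ M → ⊥
  either v∈F (inj₁ v∈K) = K#F (v∈K , v∈F)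
  either v∈F (inj₂ v∈M) = M#KF (v∈M , ∈-++⁺ʳ K v∈F)

Fresh-[] : ∀ {F : List A} → Fresh [] F
Fresh-[] = [] , λ { (() , _) }

∑-allFin-suc : ∀ {m} (c : Fin (suc m) → ℕ) → ∑ (allFin (suc m)) c ≡ c zero + ∑ (allFin m) (c ∘ suc)
∑-allFin-suc {m} c = cong (c zero +_) (trans (cong (λ l → ∑ l c) (sym (List.map-tabulate (λ i → i) suc))) (∑-map suc (allFin m) c))

-- `β` bounds the list of vertices to be avoided. Beyond these, `link` needs `k * a` neighbours of
-- each end and `2 * a` further vertices, so that `a` of them can be switched with the first end.
module Building {k n : ℕ} (H : Graph (suc k)) (G : Graph n) {a : ℕ} (α : AlphaProp H G a)
                (β : ℕ) (deg : ∀ v → β + (k * a + k * a + (a + a)) ≤ degree G v) where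

  open Tiling H G
  open CommutativeMonoidSolver (Perm.++-commutativeMonoid {A = Fin n}) using (_⊕_; _⊜_) renaming (solve to solve↭)

  private
    h : ℕ
    h = suc k
    V : Set
    V = Fin n

  nbrs : V → List V
  nbrs v = filter (λ w → adj G v w Bool.≟ true) (allFin n)

  ∈-nbrs : ∀ {v w} → w ∈ nbrs v → Adj G v w
  ∈-nbrs {v} = proj₂ ∘ ∈-filter⁻ (λ w → adj G v w Bool.≟ true) {xs = allFin n}

  nbrs-Unique : ∀ v → Unique (nbrs v)
  nbrs-Unique v = Unique.filter⁺ (λ w → adj G v w Bool.≟ true) (Unique.allFin⁺ n)

  length-nbrs : ∀ v → length (nbrs v) ≡ degree G v
  length-nbrs v = trans (length-filter (λ w → adj G v w Bool.≟ true) (allFin n))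
    (trans (∑-cong (allFin n) (λ w → cong ⟦_⟧ (does-≟true (adj G v w)))) (∑-tabulate (λ w → w) (adj G v)))

  nbrs-≥ : ∀ v {f r} → f ≤ β → r ≤ k * a + k * a + (a + a) → f + r ≤ length (nbrs v)
  nbrs-≥ v f≤ r≤ = ≤-trans (+-mono-≤ f≤ r≤) (≤-trans (deg v) (≤-reflexive (sym (length-nbrs v))))

  opaque
    coverFresh : ∀ v F → length F ≤ β → ∃ λ S → Fresh S F × length S ≡ k × Tile (v ∷ S)
    coverFresh v F |F|≤β with avoid Fin._≟_ (nbrs v) F (h * a) (nbrs-Unique v) (nbrs-≥ v |F|≤β (begin
        a + k * a                       ≡⟨ +-comm a (k * a) ⟩
        k * a + a                       ≤⟨ +-mono-≤ (m≤m+n (k * a) (k * a)) (m≤m+n a a) ⟩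
        k * a + k * a + (a + a)         ∎))
      where open ≤-Reasoning
    ... | A , A! , A⊆ , A#F , |A| with cover α v A A! (∈-nbrs ∘ A⊆) (≤-reflexive (sym |A|))
    ...   | S , S⊆A , t with Tile-Unique t
    ...     | _ ∷ S! = S , (S! , Disjoint-⊆ S⊆A id A#F) , suc-injective (Tile-length t) , t

  Switchable : V → List V → V → Set
  Switchable v A p = ∃ λ S → S ⊆ A × Tile (p ∷ S) × Tile (v ∷ S)

  opaque
    -- While at least `a` candidates remain, `switch` finds one more. The sets `S` of different
    -- candidates may overlap inside `A`; `link` uses only one of them.
    collect : ∀ v A → Unique A → (∀ {w} → w ∈ A → Adj G v w) → k * a ≤ length A →
              ∀ j P → Unique P → Disjoint P A → j + a ≤ length P →
              ∃ λ P′ → Unique P′ × P′ ⊆ P × length P′ ≡ j × (∀ {p} → p ∈ P′ → Switchable v A p)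
    collect v A A! adj ka≤ zero    P P! P#A le = [] , [] , (λ ()) , refl , λ ()
    collect v A A! adj ka≤ (suc j) P P! P#A le
      with switch α v P A (Unique.++⁺ P! A! P#A) adj ka≤ (≤-trans (m≤n+m a (suc j)) le)
    ... | p , S , p∈P , S⊆A , tp , tv with extract p∈P
    ...   | P₁ , P↭ with Unique-resp-↭ P↭ P!
    ...     | p∉P₁ ∷ P₁! with collect v A A! adj ka≤ j P₁ P₁!
                                (λ (v∈ , v∈A) → P#A (∈-resp-↭ (↭-sym P↭) (there v∈) , v∈A))
                                (≤-pred (≤-trans le (≤-reflexive (↭-length P↭))))
    ...       | P′ , P′! , P′⊆ , |P′| , sw =
      p ∷ P′ , All.anti-mono P′⊆ p∉P₁ ∷ P′! , sub , cong suc |P′| , sw′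
      where
      sub : p ∷ P′ ⊆ P
      sub (here refl) = p∈P
      sub (there v∈)  = ∈-resp-↭ (↭-sym P↭) (there (P′⊆ v∈))
      sw′ : ∀ {p′} → p′ ∈ p ∷ P′ → Switchable v A p′
      sw′ (here refl) = S , S⊆A , tp , tv
      sw′ (there p′∈) = sw p′∈

  Link : V → V → List V → Set
  Link x y K = Tiled (x ∷ K) × Tiled (y ∷ K)

  -- Some p is interchangeable both with x, inside N(x), and with y, inside N(y):
  -- fewer than a vertices are excluded in each case.
  opaque
    link : ∀ x y F → length F ≤ β → ∃ λ K → Fresh K F × length K ≤ 2 * h × Link x y K
    link x y F |F|≤β with avoid Fin._≟_ (nbrs x) F (k * a) (nbrs-Unique x)
                            (nbrs-≥ x |F|≤β (≤-trans (m≤m+n (k * a) (k * a)) (m≤m+n _ (a + a))))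
    ... | X , X! , X⊆ , X#F , |X| with avoid Fin._≟_ (nbrs y) (X ++ F) (k * a) (nbrs-Unique y) (begin
          length (X ++ F) + k * a          ≡⟨ cong (_+ k * a) (trans (List.length-++ X) (cong (_+ length F) |X|)) ⟩
          k * a + length F + k * a         ≡⟨ solve 2 (λ x f → x :+ f :+ x := f :+ (x :+ x)) refl (k * a) (length F) ⟩
          length F + (k * a + k * a)       ≤⟨ nbrs-≥ y |F|≤β (m≤m+n _ (a + a)) ⟩
          length (nbrs y)                  ∎)
      where open ≤-Reasoning
    ...   | Y , Y! , Y⊆ , Y#XF , |Y| with avoid Fin._≟_ (allFin n) (Y ++ (X ++ F)) (a + a) (Unique.allFin⁺ n) (begin
          length (Y ++ (X ++ F)) + (a + a)
            ≡⟨ cong (_+ (a + a)) (trans (List.length-++ Y) (cong₂ _+_ |Y| (trans (List.length-++ X) (cong (_+ length F) |X|)))) ⟩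
          k * a + (k * a + length F) + (a + a)
            ≡⟨ solve 3 (λ x f a → x :+ (x :+ f) :+ (a :+ a) := f :+ (x :+ x :+ (a :+ a))) refl (k * a) (length F) a ⟩
          length F + (k * a + k * a + (a + a))
            ≤⟨ nbrs-≥ y |F|≤β ≤-refl ⟩
          length (nbrs y)
            ≤⟨ Unique-⊆-length (nbrs-Unique y) (λ {v} _ → ∈-allFin v) ⟩
          length (allFin n) ∎)
      where open ≤-Reasoning
    ...     | P , P! , _ , P#YXF , |P| with collect x X X! (∈-nbrs ∘ X⊆) (≤-reflexive (sym |X|)) a P P!
                                          (λ (v∈P , v∈X) → P#YXF (v∈P , ∈-++⁺ʳ Y (∈-++⁺ˡ v∈X))) (≤-reflexive (sym |P|))
    ...       | P′ , P′! , P′⊆P , |P′| , sw with switch α y P′ Y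
                                              (Unique.++⁺ P′! Y! (λ (v∈P′ , v∈Y) → P#YXF (P′⊆P v∈P′ , ∈-++⁺ˡ v∈Y)))
                                              (∈-nbrs ∘ Y⊆) (≤-reflexive (sym |Y|)) (≤-reflexive (sym |P′|))
    ...         | p , S′ , p∈P′ , S′⊆Y , tp′ , ty with sw p∈P′
    ...           | S , S⊆X , tp , tx with Tile-Unique tx
    ...             | _ ∷ S! = S ++ p ∷ S′ ,
      (Unique.++⁺ S! (Tile-Unique tp′) S#pS′ , K#F) ,
      (begin
        length (S ++ p ∷ S′)         ≡⟨ List.length-++ S ⟩
        length S + length (p ∷ S′)   ≤⟨ +-mono-≤ (≤-trans (n≤1+n _) (≤-reflexive (Tile-length tx))) (≤-reflexive (Tile-length tp′)) ⟩
        h + h                        ≡⟨ cong (h +_) (+-identityʳ h) ⟨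
        2 * h                        ∎) ,
      cons tx (tile tp′) ,
      resp (solve↭ 4 (λ y s p s′ → (y ⊕ s′) ⊕ (p ⊕ s) ⊜ y ⊕ (s ⊕ (p ⊕ s′))) ↭-refl [ y ] S [ p ] S′)
           (cons ty (tile tp))
      where
      open ≤-Reasoning
      S#pS′ : Disjoint S (p ∷ S′)
      S#pS′ (v∈S , here refl) = P#YXF (P′⊆P p∈P′ , ∈-++⁺ʳ Y (∈-++⁺ˡ (S⊆X v∈S)))
      S#pS′ (v∈S , there v∈S′) = Y#XF (S′⊆Y v∈S′ , ∈-++⁺ˡ (S⊆X v∈S))
      K#F : Disjoint (S ++ p ∷ S′) F
      K#F (v∈ , v∈F) with ∈-++⁻ S v∈
      ... | inj₁ v∈S          = X#F (S⊆X v∈S , v∈F)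
      ... | inj₂ (here refl)  = P#YXF (P′⊆P p∈P′ , ∈-++⁺ʳ Y (∈-++⁺ʳ X v∈F))
      ... | inj₂ (there v∈S′) = Y#XF (S′⊆Y v∈S′ , ∈-++⁺ʳ X v∈F)

  opaque
    -- The entries are linked in pairs. `M` can then cover either list while the other is used
    -- elsewhere.
    bridge : ∀ bs cs F → length bs ≡ length cs → length F + length bs * (2 * h) ≤ β →
             ∃ λ M → Fresh M F × length M ≤ length bs * (2 * h) × Tiled (bs ++ M) × Tiled (cs ++ M)
    bridge []       []       F _  _  = [] , Fresh-[] , z≤n , [] , []
    bridge (b ∷ bs) (c ∷ cs) F eq le with link b c F (≤-trans (m≤m+n (length F) _) le)
    ... | K , K-fresh , |K| , tb , tc with bridge bs cs (K ++ F) (suc-injective eq) (begin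
        length (K ++ F) + length bs * (2 * h)         ≡⟨ cong (_+ length bs * (2 * h)) (List.length-++ K) ⟩
        length K + length F + length bs * (2 * h)     ≤⟨ +-monoˡ-≤ _ (+-monoˡ-≤ (length F) |K|) ⟩
        2 * h + length F + length bs * (2 * h)        ≡⟨ solve 3 (λ d f e → d :+ f :+ e := f :+ (d :+ e)) refl (2 * h) (length F) (length bs * (2 * h)) ⟩
        length F + (2 * h + length bs * (2 * h))      ≤⟨ le ⟩
        β                                             ∎)
      where open ≤-Reasoning
    ...   | M , M-fresh , |M| , tbs , tcs = K ++ M , Fresh-++ K-fresh M-fresh ,
      ≤-trans (≤-reflexive (List.length-++ K)) (+-mono-≤ |K| |M|) ,
      resp (rearrange b bs) (Tiled-++ tb tbs) , resp (rearrange c cs) (Tiled-++ tc tcs)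
      where
      rearrange : ∀ z zs → (z ∷ K) ++ (zs ++ M) ↭ (z ∷ zs) ++ (K ++ M)
      rearrange z zs = solve↭ 4 (λ z k zs m → (z ⊕ k) ⊕ (zs ⊕ m) ⊜ (z ⊕ zs) ⊕ (k ⊕ m)) ↭-refl [ z ] K zs M

  -- The cost of one option: `k` vertices completing it to a copy and `k` links of at most `2 * h`
  -- vertices, with `k` rounded up to `h`.
  takerCost : ℕ
  takerCost = h + h * (2 * h)

  Taker : List V → List V → Set
  Taker xs K = ∀ {x} → x ∈ xs → Tiled (x ∷ K)

  -- bs completes x₀ to a copy of H, and for every other x a set cs doing the same for x is bridged to bs.
  opaque
    taker : ∀ x₀ xs F → length F + suc (length xs) * takerCost ≤ β →
            ∃₂ λ bs K → Fresh (bs ++ K) F × length bs ≡ k × length (bs ++ K) ≤ suc (length xs) * takerCost ×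
                        Tiled K × Taker (x₀ ∷ xs) (bs ++ K)
    taker x₀ []       F le with coverFresh x₀ F (≤-trans (m≤m+n (length F) _) le)
    ... | bs , fresh , |bs| , t = bs , [] , subst (λ l → Fresh l F) (sym (List.++-identityʳ bs)) fresh , |bs| ,
      (begin
        length (bs ++ [])     ≡⟨ cong length (List.++-identityʳ bs) ⟩
        length bs             ≡⟨ |bs| ⟩
        k                     ≤⟨ n≤1+n k ⟩
        h                     ≤⟨ m≤m+n h _ ⟩
        takerCost             ≡⟨ +-identityʳ takerCost ⟨
        1 * takerCost         ∎) ,
      [] , λ { (here refl) → cons t [] }
      where open ≤-Reasoning
    taker x₀ (x ∷ xs) F le with taker x₀ xs F (≤-trans (+-monoʳ-≤ (length F) (m≤n+m _ takerCost)) le)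
    ... | bs , K , fresh , |bs| , |bsK| , tK , tbsK
      with coverFresh x ((bs ++ K) ++ F) (≤-trans room le)
      where
      open ≤-Reasoning
      room : length ((bs ++ K) ++ F) ≤ length F + (takerCost + suc (length xs) * takerCost)
      room = begin
        length ((bs ++ K) ++ F)        ≡⟨ List.length-++ (bs ++ K) ⟩
        length (bs ++ K) + length F    ≡⟨ +-comm (length (bs ++ K)) (length F) ⟩
        length F + length (bs ++ K)    ≤⟨ +-monoʳ-≤ (length F) (≤-trans |bsK| (m≤n+m _ takerCost)) ⟩
        length F + (takerCost + suc (length xs) * takerCost) ∎
    ...   | cs , cs-fresh , |cs| , t
      with bridge bs cs (cs ++ ((bs ++ K) ++ F)) (trans |bs| (sym |cs|)) (begin
        length (cs ++ ((bs ++ K) ++ F)) + length bs * (2 * h)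
          ≡⟨ cong (_+ length bs * (2 * h)) (trans (List.length-++ cs) (cong (length cs +_) (List.length-++ (bs ++ K)))) ⟩
        length cs + (length (bs ++ K) + length F) + length bs * (2 * h)
          ≤⟨ +-mono-≤ (+-mono-≤ (≤-trans (≤-reflexive |cs|) (n≤1+n k)) (+-monoˡ-≤ (length F) |bsK|))
                      (*-monoˡ-≤ (2 * h) (≤-trans (≤-reflexive |bs|) (n≤1+n k))) ⟩
        h + (suc (length xs) * takerCost + length F) + h * (2 * h)
          ≡⟨ solve 4 (λ c t f d → c :+ (t :+ f) :+ d := f :+ (c :+ d :+ t)) refl h (suc (length xs) * takerCost) (length F) (h * (2 * h)) ⟩
        length F + (takerCost + suc (length xs) * takerCost)
          ≤⟨ le ⟩
        β ∎)
      where open ≤-Reasoning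
    ...     | M , M-fresh , |M| , tbsM , tcsM = bs , K ++ (cs ++ M) ,
      subst (λ l → Fresh l F) (List.++-assoc bs K (cs ++ M)) (Fresh-++ fresh (Fresh-++ cs-fresh M-fresh)) , |bs| ,
      (begin
        length (bs ++ (K ++ (cs ++ M)))         ≡⟨ cong length (List.++-assoc bs K (cs ++ M)) ⟨
        length ((bs ++ K) ++ (cs ++ M))         ≡⟨ trans (List.length-++ (bs ++ K)) (cong (length (bs ++ K) +_) (List.length-++ cs)) ⟩
        length (bs ++ K) + (length cs + length M)
          ≤⟨ +-mono-≤ |bsK| (+-mono-≤ (≤-trans (≤-reflexive |cs|) (n≤1+n k))
                                      (≤-trans |M| (*-monoˡ-≤ (2 * h) (≤-trans (≤-reflexive |bs|) (n≤1+n k))))) ⟩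
        suc (length xs) * takerCost + takerCost ≡⟨ +-comm (suc (length xs) * takerCost) takerCost ⟩
        takerCost + suc (length xs) * takerCost ∎) ,
      Tiled-++ tK tcsM , takes
      where
      open ≤-Reasoning
      -- For an earlier option `M` covers `cs`. For `x`, the set `cs` is spent on its tile, `M`
      -- covers `bs` in its place, and `K` is tiled by itself.
      old : ∀ {z} → z ∈ x₀ ∷ xs → Tiled (z ∷ bs ++ (K ++ (cs ++ M)))
      old {z} z∈ = resp (↭-reflexive (cong (z ∷_) (List.++-assoc bs K (cs ++ M)))) (Tiled-++ (tbsK z∈) tcsM)
      takes : Taker (x₀ ∷ x ∷ xs) (bs ++ (K ++ (cs ++ M)))
      takes (here refl)         = old (here refl)
      takes (there (there z∈))  = old (there z∈)
      takes (there (here refl)) = resp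
        (solve↭ 5 (λ z bs k cs m → (z ⊕ cs) ⊕ ((bs ⊕ m) ⊕ k) ⊜ z ⊕ (bs ⊕ (k ⊕ (cs ⊕ m)))) ↭-refl [ x ] bs K cs M)
        (cons t (Tiled-++ tbsM tK))

  opaque
    -- The members are built one after another, each avoiding `F` and all earlier ones; the sum of
    -- the costs keeps the forbidden list within `β`.
    family : ∀ m (Good : Fin m → List V → Set) (c : Fin m → ℕ) →
             (∀ i F → length F + c i ≤ β → ∃ λ K → Fresh K F × length K ≤ c i × Good i K) →
             ∀ F → length F + ∑ (allFin m) c ≤ β →
             ∃ λ (K : Fin m → List V) → Fresh (⋃ K) F × length (⋃ K) ≤ ∑ (allFin m) c × (∀ i → Good i (K i))
    family zero    Good c make F le = (λ ()) , Fresh-[] , z≤n , λ ()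
    family (suc m) Good c make F le with make zero F (≤-trans (+-monoʳ-≤ (length F) (m≤m+n (c zero) _)) le)
    ... | K₀ , fresh₀ , |K₀| , good₀ with family m (Good ∘ suc) (c ∘ suc) (make ∘ suc) (K₀ ++ F) (begin
        length (K₀ ++ F) + ∑ (allFin m) (c ∘ suc)          ≡⟨ cong (_+ ∑ (allFin m) (c ∘ suc)) (List.length-++ K₀) ⟩
        length K₀ + length F + ∑ (allFin m) (c ∘ suc)      ≤⟨ +-monoˡ-≤ _ (+-monoˡ-≤ (length F) |K₀|) ⟩
        c zero + length F + ∑ (allFin m) (c ∘ suc)
          ≡⟨ solve 3 (λ d f e → d :+ f :+ e := f :+ (d :+ e)) refl (c zero) (length F) (∑ (allFin m) (c ∘ suc)) ⟩
        length F + (c zero + ∑ (allFin m) (c ∘ suc))       ≡⟨ cong (length F +_) (∑-allFin-suc c) ⟨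
        length F + ∑ (allFin (suc m)) c                    ≤⟨ le ⟩
        β                                                  ∎)
      where open ≤-Reasoning
    ...   | K , fresh , |K| , good = K′ , Fresh-++ fresh₀ fresh ,
      ≤-trans (≤-reflexive (List.length-++ K₀)) (≤-trans (+-mono-≤ |K₀| |K|) (≤-reflexive (sym (∑-allFin-suc c)))) , good′
      where
      K′ : Fin (suc m) → List V
      K′ zero    = K₀
      K′ (suc i) = K i
      good′ : ∀ i → Good i (K′ i)
      good′ zero    = good₀
      good′ (suc i) = good i

  Tiled-zip : ∀ {m} (f : Fin m → V) (K : Fin m → List V) → (∀ i → Tiled (f i ∷ K i)) → Tiled (tabulate f ++ ⋃ K)
  Tiled-zip f K t = resp (↭-trans (⋃-++ (λ i → [ f i ]) K) (↭-reflexive (cong (_++ ⋃ K) (⋃-singleton f)))) (Tiled-⋃ t)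

  module _ {u q : ℕ} (𝒯 : Template u q) where
    open Template 𝒯
    open Exchange 𝒯 using (Valid)

    Realises : (Slot q → V) → List V → Set
    Realises ν K = ∀ m → Valid m → Tiled (map ν (tabulate m) ++ K)

    -- One option for the initial slot of each of the `q` points, and one for each of at most
    -- `169 * u` edges.
    realisationCost : ℕ
    realisationCost = (q + 169 * u) * takerCost

    opaque
      realise : ∀ ν F → length F + realisationCost ≤ β → ∃ λ K → Fresh K F × length K ≤ realisationCost × Realises ν K
      realise ν F le = finish (family q (λ s → Taker (ν (inj₁ s) ∷ map ν (nb s))) cost make F (≤-trans (+-monoʳ-≤ (length F) total) le))
        where
        cost : Fin q → ℕ
        cost s = suc (length (nb s)) * takerCost
        make : ∀ s F → length F + cost s ≤ β → ∃ λ K → Fresh K F × length K ≤ cost s × Taker (ν (inj₁ s) ∷ map ν (nb s)) K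
        make s F le with taker (ν (inj₁ s)) (map ν (nb s)) F
            (subst (λ l → length F + suc l * takerCost ≤ β) (sym (List.length-map ν (nb s))) le)
        ... | bs , K , fresh , _ , |bsK| , _ , takes = bs ++ K , fresh ,
          subst (λ l → length (bs ++ K) ≤ suc l * takerCost) (List.length-map ν (nb s)) |bsK| , takes
        open ≤-Reasoning
        total : ∑ (allFin q) cost ≤ realisationCost
        total = begin
          ∑ (allFin q) cost
            ≡⟨ ∑-cong (allFin q) (λ s → *-comm (suc (length (nb s))) takerCost) ⟩
          ∑ (allFin q) (λ s → takerCost * suc (length (nb s)))
            ≡⟨ ∑-distribˡ (allFin q) takerCost _ ⟩
          takerCost * ∑ (allFin q) (λ s → 1 + length (nb s))
            ≡⟨ cong (takerCost *_) (∑-+ (allFin q) (λ _ → 1) (length ∘ nb)) ⟩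
          takerCost * (∑ (allFin q) (λ _ → 1) + ∑ (allFin q) (length ∘ nb))
            ≡⟨ cong (λ l → takerCost * (l + ∑ (allFin q) (length ∘ nb))) (trans (sym (length-∑ (allFin q))) (List.length-tabulate (λ (i : Fin q) → i))) ⟩
          takerCost * (q + ∑ (allFin q) (length ∘ nb))
            ≤⟨ *-monoʳ-≤ takerCost (+-monoʳ-≤ q few) ⟩
          takerCost * (q + 169 * u)
            ≡⟨ *-comm takerCost (q + 169 * u) ⟩
          realisationCost ∎
        realises : ∀ K → (∀ s → Taker (ν (inj₁ s) ∷ map ν (nb s)) (K s)) → Realises ν (⋃ K)
        realises K takes m valid = subst (λ l → Tiled (l ++ ⋃ K)) (sym (List.map-tabulate m ν)) (Tiled-zip (ν ∘ m) K t)
          where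
          t : ∀ s → Tiled (ν (m s) ∷ K s)
          t s with valid s
          ... | inj₁ eq = takes s (here (cong ν eq))
          ... | inj₂ p  = takes s (there (∈-map⁺ ν p))
        finish : (∃ λ (K : Fin q → List V) → Fresh (⋃ K) F × length (⋃ K) ≤ ∑ (allFin q) cost ×
                    (∀ s → Taker (ν (inj₁ s) ∷ map ν (nb s)) (K s))) →
                 ∃ λ K → Fresh K F × length K ≤ realisationCost × Realises ν K
        finish (K , fresh , |K| , takes) = ⋃ K , fresh , ≤-trans |K| total , realises K takes

    opaque
      realiseAll : ∀ m (ν : Fin m → Slot q → V) F → length F + m * realisationCost ≤ β →
                   ∃ λ (K : Fin m → List V) → Fresh (⋃ K) F × (∀ j → Realises (ν j) (K j))
      realiseAll m ν F le with family m (λ j → Realises (ν j)) (λ _ → realisationCost) (λ j → realise (ν j)) F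
          (subst (λ c → length F + c ≤ β)
             (sym (trans (∑-const (allFin m) realisationCost) (cong (_* realisationCost) (List.length-tabulate (λ (i : Fin m) → i))))) le)
      ... | K , fresh , _ , good = K , fresh , good

-- The flexible vertices and the factor

⟦does⟧-mono : ∀ {P Q : Set} (P? : Dec P) (Q? : Dec Q) → (P → Q) → ⟦ does P? ⟧ ≤ ⟦ does Q? ⟧
⟦does⟧-mono (yes p) (yes _) _   = ≤-refl
⟦does⟧-mono (yes p) (no ¬q) p⇒q = contradiction (p⇒q p) ¬q
⟦does⟧-mono (no _)  _       _   = z≤n

-- As long as many vertices have fewer than t neighbours in Y, adding some vertex to Y decreases
-- the total deficit substantially.
module Selection {n : ℕ} (G : Graph n) where

  private
    V : Set
    V = Fin n
    vs : List V
    vs = allFin n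
    |vs| : length vs ≡ n
    |vs| = List.length-tabulate (λ v → v)

  hits : List V → V → ℕ
  hits Y v = ∑ Y (λ y → ⟦ adj G v y ⟧)

  hits-vs : ∀ v → hits vs v ≡ degree G v
  hits-vs v = ∑-tabulate (λ w → w) (adj G v)

  module _ (t : ℕ) where

    unsat? : ∀ Y v → Dec (hits Y v < t)
    unsat? Y v = hits Y v <? t

    unsat : List V → ℕ
    unsat Y = ∑ vs (λ v → ⟦ does (unsat? Y v) ⟧)

    deficit : List V → ℕ
    deficit Y = ∑ vs (λ v → t ∸ hits Y v)

    gain : List V → V → ℕ
    gain Y y = ∑ vs (λ v → ⟦ does (unsat? Y v) ⟧ * ⟦ adj G v y ⟧)

    unsat-∷ : ∀ y Y → unsat (y ∷ Y) ≤ unsat Y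
    unsat-∷ y Y = ∑-mono vs (λ {v} _ → ⟦does⟧-mono (unsat? (y ∷ Y) v) (unsat? Y v) (≤-<-trans (m≤n+m (hits Y v) ⟦ adj G v y ⟧)))

    deficit-∷ : ∀ y Y → deficit (y ∷ Y) + gain Y y ≤ deficit Y
    deficit-∷ y Y = ≤-trans (≤-reflexive (sym (∑-+ vs _ _))) (∑-mono vs (λ {v} _ → pointwise (hits Y v) (adj G v y)))
      where
      -- Truncated subtraction loses one per new neighbour exactly as long as `s < t`, which is why
      -- `gain` counts unsatisfied vertices only.
      pointwise : ∀ s b → t ∸ (⟦ b ⟧ + s) + ⟦ does (s <? t) ⟧ * ⟦ b ⟧ ≤ t ∸ s
      pointwise s false rewrite *-zeroʳ ⟦ does (s <? t) ⟧ = ≤-reflexive (+-identityʳ (t ∸ s))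
      pointwise s true = drops (s <? t)
        where
        drops : (s<t? : Dec (s < t)) → t ∸ suc s + ⟦ does s<t? ⟧ * 1 ≤ t ∸ s
        drops (no _)    = ≤-trans (≤-reflexive (+-identityʳ _)) (∸-monoʳ-≤ t (n≤1+n s))
        drops (yes s<t) = ≤-reflexive (trans (+-comm (t ∸ suc s) 1) (sym (+-∸-assoc 1 s<t)))

    module _ {q d : ℕ} (deg : ∀ v → q + d ≤ degree G v) (q<n : q < n) where

      -- Since `Y` has fewer than `q` elements, each of at least `q` unsatisfied vertices has `d`
      -- neighbours outside `Y`. Averaged over at most `n` outside vertices, this yields one with
      -- gain at least `q * d / n`.
      someGain : ∀ Y Yᶜ → vs ↭ Y ++ Yᶜ → length Y < q → q ≤ unsat Y → ∃ λ y → y ∈ Yᶜ × q * d ≤ n * gain Y y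
      someGain Y Yᶜ vs↭ |Y|<q q≤ = average Yᶜ (λ y → n * gain Y y) (q * d) 0<|Yᶜ| (begin
          length Yᶜ * (q * d)
            ≤⟨ *-mono-≤ |Yᶜ|≤n (*-monoˡ-≤ d q≤) ⟩
          n * (unsat Y * d)
            ≡⟨ cong (n *_) (trans (*-comm (unsat Y) d) (sym (∑-distribˡ vs d _))) ⟩
          n * ∑ vs (λ v → d * ⟦ does (unsat? Y v) ⟧)
            ≤⟨ *-monoʳ-≤ n (∑-mono vs (λ {v} _ → ≤-trans (≤-reflexive (*-comm d ⟦ does (unsat? Y v) ⟧)) (*-monoʳ-≤ ⟦ does (unsat? Y v) ⟧ (outside-Y v)))) ⟩
          n * ∑ vs (λ v → ⟦ does (unsat? Y v) ⟧ * hits Yᶜ v)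
            ≡⟨ cong (n *_) (∑-cong vs (λ v → sym (∑-distribˡ Yᶜ ⟦ does (unsat? Y v) ⟧ (λ y → ⟦ adj G v y ⟧)))) ⟩
          n * ∑ vs (λ v → ∑ Yᶜ (λ y → ⟦ does (unsat? Y v) ⟧ * ⟦ adj G v y ⟧))
            ≡⟨ cong (n *_) (∑-swap vs Yᶜ _) ⟩
          n * ∑ Yᶜ (gain Y)
            ≡⟨ ∑-distribˡ Yᶜ n (gain Y) ⟨
          ∑ Yᶜ (λ y → n * gain Y y) ∎)
        where
        open ≤-Reasoning
        split : n ≡ length Y + length Yᶜ
        split = trans (sym |vs|) (trans (↭-length vs↭) (List.length-++ Y))
        |Yᶜ|≤n : length Yᶜ ≤ n
        |Yᶜ|≤n = subst (length Yᶜ ≤_) (sym split) (m≤n+m (length Yᶜ) (length Y))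
        0<|Yᶜ| : 0 < length Yᶜ
        0<|Yᶜ| = +-cancelˡ-< (length Y) 0 (length Yᶜ)
          (subst₂ _<_ (sym (+-identityʳ (length Y))) split (<-trans |Y|<q q<n))
        outside-Y : ∀ v → d ≤ hits Yᶜ v
        outside-Y v = +-cancelˡ-≤ (length Y) _ _ (begin
          length Y + d             ≤⟨ +-monoˡ-≤ d (<⇒≤ |Y|<q) ⟩
          q + d                    ≤⟨ deg v ⟩
          degree G v               ≡⟨ hits-vs v ⟨
          hits vs v                ≡⟨ trans (∑-↭ _ vs↭) (∑-++ Y Yᶜ _) ⟩
          hits Y v + hits Yᶜ v     ≤⟨ +-monoˡ-≤ (hits Yᶜ v) (∑-bounded Y _ (λ y → ⟦⟧≤1 (adj G v y))) ⟩
          length Y + hits Yᶜ v     ∎)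

      -- Either `i` additions have lowered the deficit by `i * q * d / n` from its initial value
      -- `n * t`, with denominators cleared, or at most `q` vertices are unsatisfied.
      Stage : ℕ → Set
      Stage i = ∃₂ λ Y Yᶜ → vs ↭ Y ++ Yᶜ × length Y ≡ i × (n * deficit Y + i * (q * d) ≤ n * (n * t) ⊎ unsat Y ≤ q)

      stage : ∀ i → i ≤ q → Stage i
      stage zero    _   = [] , vs , ↭-refl , refl , inj₁ (≤-reflexive (trans (+-identityʳ _)
                            (cong (n *_) (trans (∑-const vs t) (cong (_* t) |vs|)))))
      stage (suc i) i<q with stage i (<⇒≤ i<q)
      ... | Y , Yᶜ , vs↭ , |Y| , inv with unsat Y ≤? q
      ...   | no ≰q = grow (someGain Y Yᶜ vs↭ (subst (_< q) (sym |Y|) i<q) (<⇒≤ (≰⇒> ≰q))) inv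
        where
        grow : (∃ λ y → y ∈ Yᶜ × q * d ≤ n * gain Y y) → _ ⊎ unsat Y ≤ q → Stage (suc i)
        grow _              (inj₂ ≤q) = contradiction ≤q ≰q
        grow (y , y∈ , big) (inj₁ le) with extract y∈
        ... | Yᶜ′ , Yᶜ↭ = y ∷ Y , Yᶜ′ , ↭-trans vs↭ (↭-trans (Perm.++⁺ˡ Y Yᶜ↭) (shift y Y Yᶜ′)) , cong suc |Y| , inj₁ (begin
          n * deficit (y ∷ Y) + (q * d + i * (q * d))
            ≤⟨ +-monoʳ-≤ (n * deficit (y ∷ Y)) (+-monoˡ-≤ (i * (q * d)) big) ⟩
          n * deficit (y ∷ Y) + (n * gain Y y + i * (q * d))
            ≡⟨ solve 4 (λ n a b c → n :* a :+ (n :* b :+ c) := n :* (a :+ b) :+ c) refl n (deficit (y ∷ Y)) (gain Y y) (i * (q * d)) ⟩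
          n * (deficit (y ∷ Y) + gain Y y) + i * (q * d)
            ≤⟨ +-monoˡ-≤ (i * (q * d)) (*-monoʳ-≤ n (deficit-∷ y Y)) ⟩
          n * deficit Y + i * (q * d)
            ≤⟨ le ⟩
          n * (n * t) ∎)
          where open ≤-Reasoning
      ...   | yes ≤q with Yᶜ
      ...     | [] = contradiction (subst₂ _≤_ |vs| (trans (↭-length vs↭) (trans (List.length-++ Y) (trans (+-identityʳ _) |Y|))) ≤-refl)
                                   (<⇒≱ (<-trans i<q q<n))
      -- The goal is already reached, and `Y` is padded with arbitrary vertices to size exactly `q`.
      ...     | y ∷ Yᶜ′ = y ∷ Y , Yᶜ′ , ↭-trans vs↭ (shift y Y Yᶜ′) , cong suc |Y| , inj₂ (≤-trans (unsat-∷ y Y) ≤q)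

      opaque
        -- Under this inequality `q` additions cannot all have lowered the deficit as stated in
        -- `Stage`: more would be lost than was there.
        select : n * (n * t) < q * (q * d) → ∃₂ λ Y Yᶜ → vs ↭ Y ++ Yᶜ × length Y ≡ q × unsat Y ≤ q
        select lt with stage q ≤-refl
        ... | Y , Yᶜ , vs↭ , |Y| , inj₁ le = contradiction (≤-trans (m≤n+m _ (n * deficit Y)) le) (<⇒≱ lt)
        ... | Y , Yᶜ , vs↭ , |Y| , inj₂ ≤q = Y , Yᶜ , vs↭ , |Y| , ≤q

-- As `C` is at least as long as `U`, the list `R` is a suffix of `S`.
All-suffix : ∀ {P : A → Set} U {S} C {R} → U ++ S ≡ C ++ R → length U ≤ length C → All P S → All P R
All-suffix []      C       refl _       all = All.++⁻ʳ C all
All-suffix (u ∷ U) (c ∷ C) eq   (s≤s p) all = All-suffix U C (List.∷-injectiveʳ eq) p all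

preimage : (f : A → B) (ys : List B) → (∀ {y} → y ∈ ys → ∃ λ x → y ≡ f x) → ∃ λ xs → map f xs ≡ ys
preimage f []       p = [] , refl
preimage f (y ∷ ys) p with p (here refl) | preimage f ys (p ∘ there)
... | x , refl | xs , refl = x ∷ xs , refl

length-⋃ : ∀ {m c} (F : Fin m → List A) → (∀ i → length (F i) ≡ c) → length (⋃ F) ≡ m * c
length-⋃ {m = zero}  F eq = refl
length-⋃ {m = suc m} F eq = trans (List.length-++ (F zero)) (cong₂ _+_ (eq zero) (length-⋃ (F ∘ suc) (eq ∘ suc)))

module Assembly {k n : ℕ} (H : Graph (suc k)) (G : Graph n) {a : ℕ} (α : AlphaProp H G a)
                (β : ℕ) (deg : ∀ v → β + (k * a + k * a + (a + a)) ≤ degree G v) where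

  open Tiling H G
  open Building H G α β deg
  open Selection G
  open CommutativeMonoidSolver (Perm.++-commutativeMonoid {A = Fin n}) using (_⊕_; _⊜_) renaming (solve to solve↭)

  private
    h : ℕ
    h = suc k
    V : Set
    V = Fin n

  opaque
    -- Each vertex of `L` is covered by `k` of its neighbours in `Y`. The others thereby lose at
    -- most `k` neighbours each time, so `h * a` are left whenever `cover` is applied.
    absorb : ∀ L Y → Unique Y → (∀ {v} → v ∈ L → h * a + k * length L ≤ hits Y v) →
             ∃₂ λ Yᵤ Yₗ → Y ↭ Yᵤ ++ Yₗ × Tiled (L ++ Yᵤ)
    absorb []      Y Y! rich = [] , Y , ↭-refl , []
    absorb (v ∷ L) Y Y! rich with cover α v Nᵥ (Unique.filter⁺ v? Y!) (proj₂ ∘ ∈-filter⁻ v? {xs = Y})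
        (≤-trans (m≤m+n (h * a) _) (≤-trans (rich (here refl)) (≤-reflexive (sym |Nᵥ|))))
      where
      v? : ∀ w → Dec (Adj G v w)
      v? w = adj G v w Bool.≟ true
      Nᵥ : List V
      Nᵥ = filter v? Y
      |Nᵥ| : length Nᵥ ≡ hits Y v
      |Nᵥ| = trans (length-filter v? Y) (∑-cong Y (λ w → cong ⟦_⟧ (does-≟true (adj G v w))))
    ... | S , S⊆A , t with Tile-Unique t
    ...   | _ ∷ S! with complement S! (λ w∈ → proj₁ (∈-filter⁻ (λ w → adj G v w Bool.≟ true) {xs = Y} (S⊆A w∈)))
    ...     | Y′ , Y↭ with absorb L Y′ (Unique-++⁻ʳ S (Unique-resp-↭ Y↭ Y!)) rich′
      where
      open ≤-Reasoning
      rich′ : ∀ {w} → w ∈ L → h * a + k * length L ≤ hits Y′ w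
      rich′ {w} w∈ = +-cancelˡ-≤ k _ _ (begin
        k + (h * a + k * length L)       ≡⟨ solve 3 (λ k b l → k :+ (b :+ k :* l) := b :+ k :* (con 1 :+ l)) refl k (h * a) (length L) ⟩
        h * a + k * suc (length L)       ≤⟨ rich (there w∈) ⟩
        hits Y w                         ≡⟨ trans (∑-↭ _ Y↭) (∑-++ S Y′ _) ⟩
        hits S w + hits Y′ w             ≤⟨ +-monoˡ-≤ (hits Y′ w) (∑-bounded S _ (λ y → ⟦⟧≤1 (adj G w y))) ⟩
        length S + hits Y′ w             ≡⟨ cong (_+ hits Y′ w) (suc-injective (Tile-length t)) ⟩
        k + hits Y′ w                    ∎)
    ...       | Yᵤ , Yₗ , Y′↭ , tiled = S ++ Yᵤ , Yₗ ,
      ↭-trans Y↭ (↭-trans (Perm.++⁺ˡ S Y′↭) (↭-sym (Perm.++-assoc S Yᵤ Yₗ))) ,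
      resp (solve↭ 4 (λ v s l y → (v ⊕ s) ⊕ (l ⊕ y) ⊜ v ⊕ (l ⊕ (s ⊕ y))) ↭-refl [ v ] S L Yᵤ) (cons t tiled)

  module Augmentation {u q : ℕ} (𝒯 : Template u q) (a≤1+u : a ≤ suc u) (Yf : Fin q → V) (Xf : Fin h → Fin q → V) where
    open Exchange 𝒯

    ν : Fin h → Slot q → V
    ν j = [ Xf j , Yf ]′

    State : Set
    State = Fin h → Fin q → Slot q

    taken : State → List V
    taken m = ⋃ (λ j → map (ν j) (tabulate (m j)))

    opaque
      -- Structure `j` receives the flexible vertex `f j` and may release any of `u + 1` vertices.
      -- These `h` sets are disjoint and have at least `a` elements, so some copy of `H` takes one
      -- vertex from each; every structure releases the one chosen.
      step : ∀ (f : Fin h → Fin q) (m : State) → (∀ j → Valid (m j)) → Unique (tabulate (Yf ∘ f) ++ taken m) →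
             ∃₂ λ S (m′ : State) → Tile S × (∀ j → Valid (m′ j)) × tabulate (Yf ∘ f) ++ taken m ↭ S ++ taken m′
      step f m valid u! = tabulate ψ , m′ , proj₁ (proj₂ (proj₂ transversalCopy)) , valid′ ,
          ↭-trans (↭-sym gather) (↭-trans (⋃-cong exchanged) scatter)
        where
        C : Fin h → List (Slot q)
        C j = inj₂ (f j) ∷ tabulate (m j)
        gather : ⋃ (λ j → map (ν j) (C j)) ↭ tabulate (Yf ∘ f) ++ taken m
        gather = ↭-trans (⋃-++ (λ j → [ Yf (f j) ]) (λ j → map (ν j) (tabulate (m j))))
                         (↭-reflexive (cong (_++ taken m) (⋃-singleton (Yf ∘ f))))
        C! : Unique (⋃ (λ j → map (ν j) (C j)))
        C! = Unique-resp-↭ (↭-sym gather) u!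
        ex : ∀ j → ∃ λ R → Unique R × length R ≡ suc u ×
               (∀ {r} → r ∈ R → ∃ λ m′ → Valid m′ × r ∷ tabulate m′ ↭ C j)
        ex j = exchange (m j) (inj₂ (f j)) (valid j) (Unique.map⁻ (Unique-⋃⁻ {F = λ j → map (ν j) (C j)} C! j))
        R : Fin h → List (Slot q)
        R j = proj₁ (ex j)
        reach : ∀ j {r} → r ∈ R j → ∃ λ m′ → Valid m′ × r ∷ tabulate m′ ↭ C j
        reach j = proj₂ (proj₂ (proj₂ (ex j)))
        -- The flexible slots are common to all structures, so disjointness of the sets `R j` in `G`
        -- needs an argument: each lies inside `C j`, and the images of the lists `C j` are disjoint
        -- by hypothesis.
        rest : ∀ j → ∃ λ D → C j ↭ R j ++ D
        rest j = complement (proj₁ (proj₂ (ex j)))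
          (λ r∈ → let _ , _ , p = reach j r∈ in ∈-resp-↭ p (here refl))
        D : Fin h → List (Slot q)
        D j = proj₁ (rest j)
        R! : Unique (⋃ (λ j → map (ν j) (R j)))
        R! = Unique-++⁻ˡ _ (Unique-resp-↭ (↭-trans
               (⋃-cong (λ j → ↭-trans (Perm.map⁺ (ν j) (proj₂ (rest j))) (↭-reflexive (List.map-++ (ν j) (R j) (D j)))))
               (⋃-++ (λ j → map (ν j) (R j)) (λ j → map (ν j) (D j)))) C!)
        transversalCopy : ∃ λ ψ → (∀ j → ψ j ∈ map (ν j) (R j)) × Tile (tabulate ψ) ×
                         (∀ v → (∀ i → Adj G v (ψ (suc i))) → Tile (v ∷ tabulate (ψ ∘ suc)))
        transversalCopy = transversal α (λ j → map (ν j) (R j)) R! (λ j → ≤-trans a≤1+u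
                   (≤-reflexive (sym (trans (List.length-map (ν j) (R j)) (proj₁ (proj₂ (proj₂ (ex j))))))))
        ψ : Fin h → V
        ψ = proj₁ transversalCopy
        origin : ∀ j → ∃ λ r → r ∈ R j × ψ j ≡ ν j r
        origin j = ∈-map⁻ (ν j) (proj₁ (proj₂ transversalCopy) j)
        left : ∀ j → ∃ λ m′ → Valid m′ × proj₁ (origin j) ∷ tabulate m′ ↭ C j
        left j = reach j (proj₁ (proj₂ (origin j)))
        m′ : State
        m′ j = proj₁ (left j)
        valid′ : ∀ j → Valid (m′ j)
        valid′ j = proj₁ (proj₂ (left j))
        exchanged : ∀ j → map (ν j) (C j) ↭ [ ψ j ] ++ map (ν j) (tabulate (m′ j))
        exchanged j = ↭-trans (Perm.map⁺ (ν j) (↭-sym (proj₂ (proj₂ (left j)))))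
          (↭-reflexive (cong (_∷ map (ν j) (tabulate (m′ j))) (sym (proj₂ (proj₂ (origin j))))))
        scatter : ⋃ (λ j → [ ψ j ] ++ map (ν j) (tabulate (m′ j))) ↭ tabulate ψ ++ taken m′
        scatter = ↭-trans (⋃-++ (λ j → [ ψ j ]) (λ j → map (ν j) (tabulate (m′ j))))
                          (↭-reflexive (cong (_++ taken m′) (⋃-singleton ψ)))

    regroup : ∀ (f : Fin h → Fin q) Yᵣ m → tabulate f ≡ take h Yᵣ →
              map Yf Yᵣ ++ taken m ↭ (tabulate (Yf ∘ f) ++ taken m) ++ map Yf (drop h Yᵣ)
    regroup f Yᵣ m f≡ = begin
      map Yf Yᵣ ++ taken m
        ≡⟨ cong (λ l → map Yf l ++ taken m) (trans (cong (_++ Y′) f≡) (List.take++drop≡id h Yᵣ)) ⟨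
      map Yf (tabulate f ++ Y′) ++ taken m
        ≡⟨ cong (_++ taken m) (trans (List.map-++ Yf (tabulate f) Y′) (cong (_++ map Yf Y′) (List.map-tabulate f Yf))) ⟩
      (tabulate (Yf ∘ f) ++ map Yf Y′) ++ taken m
        ↭⟨ solve↭ 3 (λ x y z → (x ⊕ y) ⊕ z ⊜ (x ⊕ z) ⊕ y) ↭-refl (tabulate (Yf ∘ f)) (map Yf Y′) (taken m) ⟩
      (tabulate (Yf ∘ f) ++ taken m) ++ map Yf Y′ ∎
      where
      open Perm.PermutationReasoning
      Y′ = drop h Yᵣ

    module _ (K : Fin h → List V) (realises : ∀ j → Realises 𝒯 (ν j) (K j)) where

      taken-Tiled : ∀ m → (∀ j → Valid (m j)) → Tiled (taken m ++ ⋃ K)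
      taken-Tiled m valid = resp (⋃-++ (λ j → map (ν j) (tabulate (m j))) K) (Tiled-⋃ (λ j → realises j (m j) (valid j)))

      opaque
        -- A round gives the next `h` flexible vertices to the `h` structures, one each, and removes
        -- the copy of `H` released. After `d` rounds only occupied slots and gadgets remain, which
        -- are tiled for every valid state.
        augment : ∀ d Yᵣ (m : State) → length Yᵣ ≡ d * h → (∀ j → Valid (m j)) →
                  Unique (map Yf Yᵣ ++ taken m) → Tiled ((map Yf Yᵣ ++ taken m) ++ ⋃ K)
        augment zero    []  m _  valid u! = taken-Tiled m valid
        augment (suc d) Yᵣ m eq valid u! with untabulate (take h Yᵣ) (length-take-≤ h Yᵣ (subst (h ≤_) (sym eq) (m≤m+n h (d * h))))
        ... | f , f≡ with step f m valid (Unique-++⁻ˡ _ (Unique-resp-↭ (regroup f Yᵣ m f≡) u!))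
        ...   | S , m′ , t , valid′ , p =
          resp (↭-trans (↭-sym (Perm.++-assoc S (Y′ ++ taken m′) (⋃ K))) (Perm.++⁺ʳ (⋃ K) (↭-sym moved)))
               (cons t (augment d (drop h Yᵣ) m′ |Y′| valid′ (Unique-++⁻ʳ S (Unique-resp-↭ moved u!))))
          where
          Y′ : List V
          Y′ = map Yf (drop h Yᵣ)
          |Y′| : length (drop h Yᵣ) ≡ d * h
          |Y′| = trans (List.length-drop h Yᵣ) (trans (cong (_∸ h) eq) (m+n∸m≡n h (d * h)))
          moved : map Yf Yᵣ ++ taken m ↭ S ++ (Y′ ++ taken m′)
          moved = ↭-trans (regroup f Yᵣ m f≡) (↭-trans (Perm.++⁺ʳ Y′ p)
            (solve↭ 3 (λ s z y → (s ⊕ z) ⊕ y ⊜ s ⊕ (y ⊕ z)) ↭-refl S (taken m′) Y′))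

  module _ {u q d : ℕ} (0<u : 0 < u) (q≡4u : q ≡ 4 * u) (a≤1+u : a ≤ suc u) (h∣n : h ∣ n)
           (deg′ : ∀ v → q + d ≤ degree G v) (q<n : q < n) (room : q + h * q ≤ n)
           (budget : q + h * q + h * realisationCost (template 0<u q≡4u) ≤ β)
           (scarce : n * (n * (h * a + h * (h * a))) < q * (q * d)) where

    private
      -- `h * a` neighbours for one use of `cover`, and `h * (h * a)` to make up for those spent on
      -- a remainder of at most `h * a` vertices.
      t : ℕ
      t = h * a + h * (h * a)

      𝒯 : Template u q
      𝒯 = template 0<u q≡4u

      open Exchange 𝒯 using (Valid)

    opaque
      -- The vertices with few neighbours in Y are put into the parts X.
      partition : ∃₂ λ Y B → ∃ λ (X : Fin h → List V) →
                  allFin n ↭ Y ++ (⋃ X ++ B) × length Y ≡ q × (∀ j → length (X j) ≡ q) × (∀ {v} → v ∈ B → t ≤ hits Y v)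
      partition with select t deg′ q<n scarce
      ... | Y , Yᶜ , vs↭ , |Y| , few = finish (chunks h q (U ++ S) (+-cancelˡ-≤ q _ _ (begin
          q + h * q                ≤⟨ room ⟩
          n                        ≡⟨ List.length-tabulate (λ (v : V) → v) ⟨
          length (allFin n)        ≡⟨ trans (↭-length vs↭) (trans (List.length-++ Y) (cong₂ _+_ |Y| (↭-length Yᶜ↭))) ⟩
          q + length (U ++ S)      ∎)))
        where
        open ≤-Reasoning
        U S : List V
        U = filter (unsat? t Y) Yᶜ
        S = filter (λ v → ¬? (unsat? t Y v)) Yᶜ
        Yᶜ↭ : Yᶜ ↭ U ++ S
        Yᶜ↭ = filter-++-↭ (unsat? t Y) Yᶜ
        |U|≤q : length U ≤ q
        |U|≤q = begin
          length U                                        ≡⟨ length-filter (unsat? t Y) Yᶜ ⟩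
          ∑ Yᶜ (λ v → ⟦ does (unsat? t Y v) ⟧)            ≤⟨ m≤n+m _ _ ⟩
          ∑ Y (λ v → ⟦ does (unsat? t Y v) ⟧) + ∑ Yᶜ (λ v → ⟦ does (unsat? t Y v) ⟧)
                                                          ≡⟨ trans (∑-↭ _ vs↭) (∑-++ Y Yᶜ _) ⟨
          unsat t Y                                       ≤⟨ few ⟩
          q                                               ∎
        finish : (∃₂ λ (X : Fin h → List V) B → (∀ j → length (X j) ≡ q) × ⋃ X ++ B ≡ U ++ S) →
                 ∃₂ λ Y B → ∃ λ (X : Fin h → List V) →
                 allFin n ↭ Y ++ (⋃ X ++ B) × length Y ≡ q × (∀ j → length (X j) ≡ q) × (∀ {v} → v ∈ B → t ≤ hits Y v)
        finish (X , B , |X| , XB≡) = Y , B , X ,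
          ↭-trans vs↭ (Perm.++⁺ˡ Y (↭-trans Yᶜ↭ (↭-reflexive (sym XB≡)))) , |Y| , |X| ,
          λ v∈ → ≮⇒≥ (All.lookup satB v∈)
          where
          -- The vertices of `U` come first and number at most `q`, so the first part already takes
          -- them all and `B` lies within `S`.
          satB : All (λ v → ¬ (hits Y v < t)) B
          satB = All-suffix U (⋃ X) (sym XB≡)
            (≤-trans |U|≤q (begin
              q                                  ≡⟨ |X| zero ⟨
              length (X zero)                    ≤⟨ m≤m+n (length (X zero)) _ ⟩
              length (X zero) + length (⋃ (X ∘ suc)) ≡⟨ List.length-++ (X zero) ⟨
              length (⋃ X)                       ∎))
            (All.tabulate (λ v∈ → proj₂ (∈-filter⁻ (λ v → ¬? (unsat? t Y v)) {xs = Yᶜ} v∈)))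

    module _ (Yf : Fin q → V) (Xf : Fin h → Fin q → V) (B₀ : List V)
             (vs↭ : allFin n ↭ tabulate Yf ++ (⋃ (tabulate ∘ Xf) ++ B₀))
             (sat : ∀ {v} → v ∈ B₀ → t ≤ hits (tabulate Yf) v) where

      open Augmentation 𝒯 a≤1+u Yf Xf

      private
        Y X F : List V
        Y = tabulate Yf
        X = ⋃ (tabulate ∘ Xf)
        F = Y ++ X

        vs! : Unique (Y ++ (X ++ B₀))
        vs! = Unique-resp-↭ vs↭ (Unique.allFin⁺ n)

        m₀ : State
        m₀ j s = inj₁ s

        valid₀ : ∀ j → Valid (m₀ j)
        valid₀ j s = inj₁ refl

        taken₀ : taken m₀ ↭ X
        taken₀ = ⋃-cong (λ j → ↭-reflexive (List.map-tabulate (m₀ j) (ν j)))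

        F-room : length F + h * realisationCost 𝒯 ≤ β
        F-room = subst (λ l → l + h * realisationCost 𝒯 ≤ β) (sym (trans (List.length-++ Y)
          (cong₂ _+_ (List.length-tabulate Yf) (length-⋃ (tabulate ∘ Xf) (List.length-tabulate ∘ Xf))))) budget

      opaque
        -- With the initial assignments everything except `Yᵣ` is tiled, so its size is a multiple
        -- of `h`. As `h` divides `n`, the size of `Yᵣ` is a multiple of `h` too, as `augment`
        -- requires.
        finish : ∀ (K : Fin h → List V) (realises : ∀ j → Realises 𝒯 (ν j) (K j)) T L Yᵤ Yᵣ → Tiled T → Tiled (L ++ Yᵤ) →
                 allFin n ↭ ((T ++ (L ++ Yᵤ)) ++ (taken m₀ ++ ⋃ K)) ++ map Yf Yᵣ → Tiled (allFin n)
        finish K realises T L Yᵤ Yᵣ tT tLY all↭ with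
            ∣m+n∣m⇒∣n (subst (h ∣_) (trans (sym (List.length-tabulate (λ (v : V) → v)))
                         (trans (↭-length all↭) (trans (List.length-++ ((T ++ (L ++ Yᵤ)) ++ (taken m₀ ++ ⋃ K)))
                           (cong (length ((T ++ (L ++ Yᵤ)) ++ (taken m₀ ++ ⋃ K)) +_) (List.length-map Yf Yᵣ))))) h∣n)
                      (Tiled-length (Tiled-++ (Tiled-++ tT tLY) (taken-Tiled K realises m₀ valid₀)))
        ... | divides d |Yᵣ| = resp (↭-sym regrouped)
          (Tiled-++ (Tiled-++ tT tLY) (augment K realises d Yᵣ m₀ |Yᵣ| valid₀
            (Unique-++⁻ˡ _ (Unique-++⁻ʳ (T ++ (L ++ Yᵤ)) (Unique-resp-↭ regrouped (Unique.allFin⁺ n))))))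
          where
          regrouped : allFin n ↭ (T ++ (L ++ Yᵤ)) ++ ((map Yf Yᵣ ++ taken m₀) ++ ⋃ K)
          regrouped = ↭-trans all↭ (solve↭ 4 (λ t x k y → (t ⊕ (x ⊕ k)) ⊕ y ⊜ t ⊕ ((y ⊕ x) ⊕ k)) ↭-refl
            (T ++ (L ++ Yᵤ)) (taken m₀) (⋃ K) (map Yf Yᵣ))

      opaque
        assemble : Tiled (allFin n)
        assemble with realiseAll 𝒯 h ν F F-room
        ... | K , (K! , K#F) , realises with complement K! K⊆B₀
          where
          -- The gadgets avoid both `Y` and `X`, hence lie in the rest.
          K⊆B₀ : ⋃ K ⊆ B₀
          K⊆B₀ {v} v∈K with ∈-++⁻ Y (∈-resp-↭ vs↭ (∈-allFin v))
          ... | inj₁ v∈Y = ⊥-elim (K#F (v∈K , ∈-++⁺ˡ v∈Y))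
          ... | inj₂ v∈XB with ∈-++⁻ X v∈XB
          ...   | inj₁ v∈X = ⊥-elim (K#F (v∈K , ∈-++⁺ʳ Y v∈X))
          ...   | inj₂ v∈B = v∈B
        ...   | B , B₀↭ with greedy α B (Unique-++⁻ʳ (⋃ K) (Unique-resp-↭ B₀↭ (Unique-++⁻ʳ X (Unique-++⁻ʳ Y vs!))))
        ...     | T , L , B↭ , tT , |L| with absorb L Y (Unique-++⁻ˡ Y vs!) rich
          where
          -- The greedy remainder has at most `h * a` vertices, which is the case that `t` was
          -- chosen for.
          rich : ∀ {v} → v ∈ L → h * a + k * length L ≤ hits Y v
          rich {v} v∈L = ≤-trans (+-monoʳ-≤ (h * a) (*-mono-≤ (n≤1+n k) |L|))
            (sat (∈-resp-↭ (↭-sym B₀↭) (∈-++⁺ʳ (⋃ K) (∈-resp-↭ (↭-sym B↭) (∈-++⁺ʳ T v∈L)))))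
        ...       | Yᵤ , Yₗ , Y↭ , tLY with preimage Yf Yₗ (λ y∈ → ∈-tabulate⁻ (∈-resp-↭ (↭-sym Y↭) (∈-++⁺ʳ Yᵤ y∈)))
        ...         | Yᵣ , refl = finish K realises T L Yᵤ Yᵣ tT tLY (↭-trans vs↭ (↭-trans
          (Perm.++⁺ Y↭ (Perm.++⁺ (↭-sym taken₀) (↭-trans B₀↭ (Perm.++⁺ˡ (⋃ K) B↭))))
          (solve↭ 6 (λ yu yl x k t l → (yu ⊕ yl) ⊕ (x ⊕ (k ⊕ (t ⊕ l))) ⊜ ((t ⊕ (l ⊕ yu)) ⊕ (x ⊕ k)) ⊕ yl) ↭-refl
            Yᵤ (map Yf Yᵣ) (taken m₀) (⋃ K) T L)))

    opaque
      hasFactor : HFactor H G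
      hasFactor with partition
      ... | Y , B , X , vs↭ , |Y| , |X| , sat with untabulate Y |Y|
      ...   | Yf , refl = Tiled⇒HFactor (assemble Yf Xf B
          (↭-trans vs↭ (Perm.++⁺ˡ (tabulate Yf) (Perm.++⁺ʳ B (⋃-cong (λ j → ↭-reflexive (sym (Xf≡ j))))))) sat)
        where
        Xf : Fin h → Fin q → V
        Xf j = proj₁ (untabulate (X j) (|X| j))
        Xf≡ : ∀ j → tabulate (Xf j) ≡ X j
        Xf≡ j = proj₂ (untabulate (X j) (|X| j))

-- Choice of constants and passage from rationals to naturals

parameters : ∀ D c {a n : ℕ} .{{_ : NonZero D}} → D * c * a ≤ n → 0 < c * a →
             ∃ λ u → c * a ≤ u × D * u ≤ n × n ≤ 2 * (D * u) × 0 < u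
parameters D c {a} {n} le 0<ca = u , c≤u , Du≤n , n≤2Du , ≤-trans 0<ca c≤u
  where
  open ≤-Reasoning
  u : ℕ
  u = n / D
  c≤u : c * a ≤ u
  c≤u = subst (_≤ u) (m*n/n≡m (c * a) D) (/-monoˡ-≤ D (≤-trans (≤-reflexive (trans (*-comm (c * a) D) (sym (*-assoc D c a)))) le))
  Du≤n : D * u ≤ n
  Du≤n = ≤-trans (≤-reflexive (*-comm D u)) (m/n*n≤m n D)
  -- The remainder of `n` modulo `D` is below `D`, and `D` is at most `D * u` because `u` is
  -- positive.
  n≤2Du : n ≤ 2 * (D * u)
  n≤2Du = begin
    n                ≡⟨ m≡m%n+[m/n]*n n D ⟩
    n % D + u * D    ≤⟨ +-monoˡ-≤ (u * D) (<⇒≤ (m%n<n n D)) ⟩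
    D + u * D        ≤⟨ +-monoˡ-≤ (u * D) (≤-trans (≤-reflexive (sym (+-identityʳ D))) (*-monoˡ-≤ D (≤-trans 0<ca c≤u))) ⟩
    u * D + u * D    ≡⟨ solve 2 (λ u d → u :* d :+ u :* d := con 2 :* (d :* u)) refl u D ⟩
    2 * (D * u)      ∎

module _ {k : ℕ} (H : Graph (suc k)) (e : ℕ) where

  -- D′ * u bounds the number of vertices of the construction, and u = n / D.
  private
    h = suc k
    tc = h + h * (2 * h)
    D′ = 4 + h * 4 + h * (173 * tc) + 2 * h
    D = suc e * D′
    -- Chosen for `scarce`: `n ≤ 2 * D * u` bounds its left side by `8 * u * u * (c * a)`, at most
    -- `8 * u ^ 3`, while its right side is `16 * u ^ 3`.
    c = D * D * (h * h)

  threshold : ℕ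
  threshold = D * c

  opaque
    factorℕ : ∀ {n} (G : Graph n) → h ∣ n → (∀ v → n ≤ suc e * degree G v) →
              ∀ {a} → 0 < a → AlphaProp H G a → threshold * a ≤ n → HFactor H G
    factorℕ {n} G h∣n deg {a} 0<a α le = finish (parameters D c le (*-mono-≤ {1} {c} (s≤s z≤n) 0<a))
      where
      open ≤-Reasoning
      finish : (∃ λ u → c * a ≤ u × D * u ≤ n × n ≤ 2 * (D * u) × 0 < u) → HFactor H G
      finish (u , ca≤u , Du≤n , n≤2Du , 0<u) = go (4 * u) refl
        where
        a≤u : a ≤ u
        a≤u = ≤-trans (≤-trans (≤-reflexive (sym (*-identityˡ a))) (*-monoˡ-≤ a {1} {c} (s≤s z≤n))) ca≤u
        D′u≤deg : ∀ v → D′ * u ≤ degree G v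
        D′u≤deg v = *-cancelˡ-≤ (suc e) (begin
          suc e * (D′ * u)       ≡⟨ *-assoc (suc e) D′ u ⟨
          D * u                  ≤⟨ Du≤n ⟩
          n                      ≤⟨ deg v ⟩
          suc e * degree G v     ∎)
        D′u≤n : D′ * u ≤ n
        D′u≤n = ≤-trans (*-monoˡ-≤ u (m≤m+n D′ (e * D′))) Du≤n
        go : ∀ q → q ≡ 4 * u → HFactor H G
        go q q≡4u = Assembly.hasFactor H G α β deg₁ 0<u q≡4u (≤-trans a≤u (n≤1+n u)) h∣n deg₂ q<n room budget scarce
          where
          -- The flexible vertices and the `h` parts take `(4 + h * 4) * u` vertices. The gadgets of
          -- each structure take `173 * u` times `tc`, where `173` is `4 + 169`.
          β : ℕ
          β = (4 + h * 4 + h * (173 * tc)) * u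
          deg₁ : ∀ v → β + (k * a + k * a + (a + a)) ≤ degree G v
          deg₁ v = begin
            β + (k * a + k * a + (a + a))   ≡⟨ cong (β +_) (solve 2 (λ k a → k :* a :+ k :* a :+ (a :+ a) := con 2 :* (con 1 :+ k) :* a) refl k a) ⟩
            β + 2 * h * a                   ≤⟨ +-monoʳ-≤ β (*-monoʳ-≤ (2 * h) a≤u) ⟩
            β + 2 * h * u                   ≡⟨ *-distribʳ-+ u (4 + h * 4 + h * (173 * tc)) (2 * h) ⟨
            D′ * u                          ≤⟨ D′u≤deg v ⟩
            degree G v                      ∎
          q+hq≡ : q + h * q ≡ (4 + h * 4) * u
          q+hq≡ = trans (cong (λ q → q + h * q) q≡4u) (solve 2 (λ u h → con 4 :* u :+ h :* (con 4 :* u) := (con 4 :+ h :* con 4) :* u) refl u h)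
          q+hq≤ : q + h * q ≤ D′ * u
          q+hq≤ = ≤-trans (≤-reflexive q+hq≡) (*-monoˡ-≤ u (≤-trans (m≤m+n (4 + h * 4) (h * (173 * tc))) (m≤m+n _ (2 * h))))
          q+u≤ : q + u ≤ D′ * u
          q+u≤ = ≤-trans (+-monoʳ-≤ q (≤-trans (m≤m+n u _) (≤-trans (≤-reflexive (sym q≡4u)) (m≤m+n q (k * q))))) q+hq≤
          deg₂ : ∀ v → q + u ≤ degree G v
          deg₂ v = ≤-trans q+u≤ (D′u≤deg v)
          q<n : q < n
          q<n = ≤-trans (≤-trans (≤-reflexive (+-comm 1 q)) (+-monoʳ-≤ q 0<u)) (≤-trans q+u≤ D′u≤n)
          room : q + h * q ≤ n
          room = ≤-trans q+hq≤ D′u≤n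
          budget : q + h * q + h * ((q + 169 * u) * tc) ≤ β
          budget = ≤-reflexive (trans (cong₂ (λ x y → x + h * ((y + 169 * u) * tc)) q+hq≡ q≡4u)
            (solve 3 (λ u h t → (con 4 :+ h :* con 4) :* u :+ h :* ((con 4 :* u :+ con 169 :* u) :* t)
                             := (con 4 :+ h :* con 4 :+ h :* (con 173 :* t)) :* u) refl u h tc))
          scarce : n * (n * (h * a + h * (h * a))) < q * (q * u)
          scarce = begin-strict
            n * (n * (h * a + h * (h * a)))
              ≤⟨ *-mono-≤ n≤2Du (*-mono-≤ n≤2Du (+-monoˡ-≤ (h * (h * a)) (m≤m+n (h * a) (k * (h * a))))) ⟩
            2 * (D * u) * (2 * (D * u) * (h * (h * a) + h * (h * a)))
              ≡⟨ solve 4 (λ d u h a → con 2 :* (d :* u) :* (con 2 :* (d :* u) :* (h :* (h :* a) :+ h :* (h :* a)))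
                                   := con 8 :* (u :* (u :* (d :* d :* (h :* h) :* a)))) refl D u h a ⟩
            8 * (u * (u * (c * a)))
              ≤⟨ *-monoʳ-≤ 8 (*-monoʳ-≤ u (*-monoʳ-≤ u ca≤u)) ⟩
            8 * (u * (u * u))
              <⟨ *-monoˡ-< (u * (u * u)) {{>-nonZero (*-mono-≤ 0<u (*-mono-≤ 0<u 0<u))}} {8} {16} (m≤m+n 9 7) ⟩
            16 * (u * (u * u))
              ≡⟨ solve 1 (λ u → con 16 :* (u :* (u :* u)) := con 4 :* u :* (con 4 :* u :* u)) refl u ⟩
            4 * u * (4 * u * u)
              ≡⟨ cong₂ (λ x y → x * (y * u)) q≡4u q≡4u ⟨
            q * (q * u) ∎

-- Empty parts contain no copy of a graph that has a vertex.
alpha-positive : ∀ {k n a} (H : Graph (suc k)) (G : Graph n) → AlphaProp H G a → 0 < a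
alpha-positive {a = suc a} H G α = s≤s z≤n
alpha-positive {a = zero}  H G α with α (λ _ → Subset.⊥) (λ _ _ _ v∈ _ → contradiction v∈ Subset.∉⊥) (λ _ → z≤n)
... | _ , _ , _ , φ∈ , _ = contradiction (φ∈ zero) Subset.∉⊥

ℕtoℚᵘ : ∀ m → toℚᵘ (ℕtoℚ m) ℚᵘ.≃ mkℚᵘ (pos m) 0
ℕtoℚᵘ m = ℚ.toℚᵘ-fromℚᵘ (mkℚᵘ (pos m) 0)

-- On unnormalised rationals the order is cross multiplication, so the inequality becomes one
-- between integers.
clear-≤ : ∀ ε m n → ε ℚ.* ℕtoℚ m ℚ.≤ ℕtoℚ n → toℚᵘ ε ℚᵘ.* mkℚᵘ (pos m) 0 ℚᵘ.≤ mkℚᵘ (pos n) 0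
clear-≤ ε m n le = ℚᵘ.≤-respˡ-≃ (ℚᵘ.≃-trans (ℚ.toℚᵘ-homo-* ε (ℕtoℚ m)) (ℚᵘ.*-congˡ {toℚᵘ ε} (ℕtoℚᵘ m)))
  (ℚᵘ.≤-respʳ-≃ (ℕtoℚᵘ n) (ℚ.toℚᵘ-mono-≤ le))

-- The numerator of a positive `ε` is at least one, so `ε` is at least the reciprocal of its
-- denominator.
degree-≥ : ∀ ε → 0ℚ ℚ.< ε → ∀ {m n} → ε ℚ.* ℕtoℚ m ℚ.≤ ℕtoℚ n → m ≤ suc (ℚ.ℚ.denominator-1 ε) * n
degree-≥ ε@(mkℚ (pos (suc p)) d _) _ {m} {n} le with clear-≤ ε m n le
... | *≤* ineq = begin
  m                  ≤⟨ m≤m+n m (p * m) ⟩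
  suc p * m          ≡⟨ *-identityʳ (suc p * m) ⟨
  suc p * m * 1      ≤⟨ ℤ.drop‿+≤+ (subst₂ ℤ._≤_ lhs (sym (ℤ.pos-* n (suc d * 1))) ineq) ⟩
  n * (suc d * 1)    ≡⟨ solve 2 (λ n d → n :* (d :* con 1) := d :* n) refl n (suc d) ⟩
  suc d * n          ∎
  where
  open ≤-Reasoning
  lhs : pos (suc p) ℤ.* pos m ℤ.* pos 1 ≡ pos (suc p * m * 1)
  lhs = trans (cong (ℤ._* pos 1) (sym (ℤ.pos-* (suc p) m))) (sym (ℤ.pos-* (suc p * m) 1))
degree-≥ (mkℚ (pos zero)     _ _) (ℚ.*<* (ℤ.+<+ ()))
degree-≥ (mkℚ (ℤ.-[1+ _ ]) _ _) (ℚ.*<* ())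

alpha-≤ : ∀ b {m n} → ℕtoℚ m ℚ.≤ (pos 1 ℚ./ suc b) ℚ.* ℕtoℚ n → suc b * m ≤ n
alpha-≤ b {m} {n} le with ℚᵘ.≤-respˡ-≃ (ℕtoℚᵘ m) (ℚᵘ.≤-respʳ-≃
    (ℚᵘ.≃-trans (ℚ.toℚᵘ-homo-* (pos 1 ℚ./ suc b) (ℕtoℚ n)) (ℚᵘ.*-cong (ℚ.toℚᵘ-fromℚᵘ (mkℚᵘ (pos 1) b)) (ℕtoℚᵘ n)))
    (ℚ.toℚᵘ-mono-≤ le))
... | *≤* ineq = begin
  suc b * m          ≡⟨ solve 2 (λ m b → b :* m := m :* (b :* con 1)) refl m (suc b) ⟩
  m * (suc b * 1)    ≤⟨ ℤ.drop‿+≤+ (subst₂ ℤ._≤_ (sym (ℤ.pos-* m (suc b * 1))) rhs ineq) ⟩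
  1 * n * 1          ≡⟨ trans (*-identityʳ (1 * n)) (*-identityˡ n) ⟩
  n                  ∎
  where
  open ≤-Reasoning
  rhs : pos 1 ℤ.* pos n ℤ.* pos 1 ≡ pos (1 * n * 1)
  rhs = trans (cong (ℤ._* pos 1) (sym (ℤ.pos-* 1 n))) (sym (ℤ.pos-* (1 * n) 1))

theorem1p4 : ∀ {h : ℕ} (H : Graph h) (ε : ℚ) → 0ℚ ℚ.< ε →
    Σ ℚ λ ε' → 0ℚ ℚ.< ε' ×
    (∀ (n : ℕ) (G : Graph n) → h ∣ n →
    MinDegAtLeast G (ε ℚ.* ℕtoℚ n) →
    Σ ℕ (λ a → IsAlphaStar H G a × ℕtoℚ a ℚ.≤ ε' ℚ.* ℕtoℚ n) →
    HFactor H G)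
-- If `H` has no vertices, divisibility by zero forces `n` to be zero, and the empty family is a
-- factor.
theorem1p4 {zero}  H ε 0<ε = ε , 0<ε , λ n G 0∣n _ _ → emptyFactor n G (0∣⇒≡0 0∣n)
  where
  emptyFactor : ∀ n (G : Graph n) → n ≡ 0 → HFactor H G
  emptyFactor _ G refl = 0 , (λ ()) , (λ ()) , (λ ()) , λ ()
theorem1p4 {suc k} H ε 0<ε =
  -- With this `ε'` the bound on `a` gives `suc b * a ≤ n`, hence `threshold * a ≤ n`.
  pos 1 ℚ./ suc b , ℚ.positive⁻¹ (pos 1 ℚ./ suc b) {{ℚ.normalize-pos 1 (suc b)}} ,
  λ n G h∣n deg (a , (α , _) , a≤) →
    factorℕ H e G h∣n (λ v → degree-≥ ε 0<ε {n} {degree G v} (deg v)) (alpha-positive H G α) α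
      (≤-trans (*-monoˡ-≤ a (n≤1+n b)) (alpha-≤ b {a} {n} a≤))
  where
  e b : ℕ
  e = ℚ.ℚ.denominator-1 ε
  b = threshold H e
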